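{- Let $F$ be a CNF propositional formula over variables $z_1,\ldots,z_n$ with set of satisfying assignments $R_F\subseteq\{0,1\}^n$, and let $0<\varepsilon\le1$ and $0<\delta\le1$. Suppose $\mathsf{ApproxMC}(F,\varepsilon,\delta)$ returns $c$. Then $$\Pr\left[(1+\varepsilon)^{ -1}|R_F|\le c\le(1+\varepsilon)|R_F|\right]\ \ge\ 1-\delta.$$
   Context: Hash family: for positive integers $n,m$, $H_{xor}(n,m,3)$ is the family of functions $h:\{0,1\}^n\to\{0,1\}^m$ of the form $h(y)[j]=a_{j,0}\oplus\bigoplus_{k=1}^n a_{j,k}\cdot y[k]$ for $1\le j\le m$, with $a_{j,k}\in\{0,1\}$; a random $h$ is chosen by picking all $a_{j,k}$ independently and uniformly at random. $\mathsf{BoundedSAT}(F',v)$, for a formula $F'$ (a CNF formula conjoined with xor constraints) and integer $v\ge0$, returns a set of $\min(v,\#F')$ satisfying assignments of $F'$, where $\#F'$ is the number of satisfying assignments. $\mathsf{ApproxMCCore}(F,\mathit{pivot})$: let $S\leftarrow\mathsf{BoundedSAT}(F,\mathit{pivot}+1)$; if $|S|\le\mathit{pivot}$, return $|S|$. Otherwise set $l\leftarrow\lfloor\log_2\mathit{pivot}\rfloor-1$ and $i\leftarrow l-1$, and repeat: $i\leftarrow i+1$; choose $h$ uniformly at random from $H_{xor}(n,i-l,3)$; choose $\alpha$ uniformly at random from $\{0,1\}^{i-l}$ (all choices independent of previous ones); $S\leftarrow\mathsf{BoundedSAT}(F\wedge(h(z_1,\ldots,z_n)=\alpha),\mathit{pivot}+1)$;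 until $1\le|S|\le\mathit{pivot}$ or $i=n$. Then if $|S|>\mathit{pivot}$ or $|S|=0$ return $\bot$, else return $|S|\cdot 2^{i-l}$. $\mathsf{ApproxMC}(F,\varepsilon,\delta)$ sets $\mathit{pivot}=2\lceil 3e^{1/2}(1+1/\varepsilon)^2\rceil$ and $t=\lceil 35\log_2(3/\delta)\rceil$, runs $\mathsf{ApproxMCCore}(F,\mathit{pivot})$ $t$ times independently, and returns the median of the non-$\bot$ values returned ($\bot$ if there are none).
   Formalization: The tolerance ε and the confidence parameter δ range over the rational numbers in (0,1] instead of the real numbers; pivot and t are the exact ceilings for these values. -}

module Defs where

open import Data.Bool using (Bool; true; false; _∧_; _∨_; _xor_; if_then_else_; not)
open import Data.Nat as ℕ using (ℕ; zero; suc; _∸_; _⊓_; _!; _≤ᵇ_; _≡ᵇ_)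
open import Data.Nat.Properties using (_!≢0; ≤-decTotalOrder)
open import Data.Nat.DivMod using (_/_; _%_)
open import Data.Nat.Logarithm using (⌊log₂_⌋)
open import Data.Fin using (Fin)
open import Data.Vec as Vec using (Vec; []; _∷_; lookup)
open import Data.List as List using (List; []; _∷_; length; _++_; concatMap; drop; catMaybes)
open import Data.Maybe using (Maybe; just; nothing)
open import Data.Product using (_×_; _,_)
open import Data.Unit using (⊤; tt)
open import Data.Integer using (+_)
open import Data.Rational as ℚ using (ℚ; 0ℚ; 1ℚ; _≤_; _<_; 1/_)
open import Data.Rational.Properties using (_≤?_; +-mono-<; positive⁻¹)
open import Relation.Nullary using (does)
import Data.List.Sort
import Data.Bool.ListAction as BL

ℕ→ℚ : ℕ → ℚ
ℕ→ℚ n = ℚ._/_ (+ n) 1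

_^ℚ_ : ℚ → ℕ → ℚ
q ^ℚ zero  = 1ℚ
q ^ℚ suc k = q ℚ.* (q ^ℚ k)

-- Assignments and CNF formulas over variables z_1 … z_n
-- (variable z_{k+1} is index k : Fin n; an assignment is y ∈ {0,1}^n)

Assignment : ℕ → Set
Assignment n = Vec Bool n

Literal : ℕ → Set
Literal n = Bool × Fin n

Clause : ℕ → Set
Clause n = List (Literal n)

CNF : ℕ → Set
CNF n = List (Clause n)

evalLit : ∀ {n} → Literal n → Assignment n → Bool
evalLit (b , k) y = if b then lookup y k else not (lookup y k)

evalClause : ∀ {n} → Clause n → Assignment n → Bool
evalClause c y = BL.any (λ l → evalLit l y) c

evalCNF : ∀ {n} → CNF n → Assignment n → Bool
evalCNF F y = BL.all (λ c → evalClause c y) F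

allVecsOf : ∀ {A : Set} → List A → (m : ℕ) → List (Vec A m)
allVecsOf xs zero    = [] ∷ []
allVecsOf xs (suc m) = concatMap (λ x → List.map (x ∷_) (allVecsOf xs m)) xs

allAssignments : (n : ℕ) → List (Assignment n)
allAssignments n = allVecsOf (false ∷ true ∷ []) n

countTrue : ∀ {A : Set} → (A → Bool) → List A → ℕ
countTrue p []       = 0
countTrue p (x ∷ xs) = if p x then suc (countTrue p xs) else countTrue p xs

#sat : ∀ {n} → (Assignment n → Bool) → ℕ
#sat {n} φ = countTrue φ (allAssignments n)

∣R_∣ : ∀ {n} → CNF n → ℕ
∣R_∣ F = #sat (evalCNF F)

-- one output bit: (a_{j,0} , (a_{j,1},…,a_{j,n}))
HashRow : ℕ → Set
HashRow n = Bool × Vec Bool n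

-- h ∈ H_xor(n,m,3), given by its coefficients a_{j,k}
Hash : ℕ → ℕ → Set
Hash n m = Vec (HashRow n) m

applyRow : ∀ {n} → HashRow n → Assignment n → Bool
applyRow (a₀ , a) y = a₀ xor Vec.foldr _ _xor_ false (Vec.zipWith _∧_ a y)

applyHash : ∀ {n m} → Hash n m → Assignment n → Vec Bool m
applyHash h y = Vec.map (λ r → applyRow r y) h

eqBits : ∀ {m} → Vec Bool m → Vec Bool m → Bool
eqBits []       []       = true
eqBits (a ∷ as) (b ∷ bs) = not (a xor b) ∧ eqBits as bs

allHashRows : (n : ℕ) → List (HashRow n)
allHashRows n = List.cartesianProduct (false ∷ true ∷ []) (allAssignments n)

-- the random choices of one iteration of the loop with i - l = m :
-- h ∈ H_xor(n,m,3) and α ∈ {0,1}^m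
HashStep : ℕ → ℕ → Set
HashStep n m = Hash n m × Vec Bool m

allHashSteps : (n m : ℕ) → List (HashStep n m)
allHashSteps n m = List.cartesianProduct (allVecsOf (allHashRows n) m) (allAssignments m)

-- random tape for k successive iterations with i - l = m, m+1, …, m+k-1
CoreTape : ℕ → ℕ → ℕ → Set
CoreTape n m zero    = ⊤
CoreTape n m (suc k) = HashStep n m × CoreTape n (suc m) k

allCoreTapes : (n m k : ℕ) → List (CoreTape n m k)
allCoreTapes n m zero    = tt ∷ []
allCoreTapes n m (suc k) = List.cartesianProduct (allHashSteps n m) (allCoreTapes n (suc m) k)

-- BoundedSAT (only the size of the returned set is ever used)

∣BoundedSAT∣ : ∀ {n} → (Assignment n → Bool) → ℕ → ℕ
∣BoundedSAT∣ φ v = v ⊓ #sat φ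

-- ApproxMCCore.  nothing = ⊥.

lOf : ℕ → ℕ
lOf pivot = ⌊log₂ pivot ⌋ ∸ 1

-- the repeat-loop, at the iteration with i - l = m, with k further
-- iterations remaining after this one (the last one has i = n)
coreLoop : ∀ {n} → CNF n → (pivot m k : ℕ) → CoreTape n m (suc k) → Maybe ℕ
coreLoop F pivot m k ((h , α) , rest) =
  let s = ∣BoundedSAT∣ (λ y → evalCNF F y ∧ eqBits (applyHash h y) α) (suc pivot) in
  if (1 ≤ᵇ s) ∧ (s ≤ᵇ pivot) then just (s ℕ.* (2 ℕ.^ m)) else next k rest
  where
  next : (k : ℕ) → CoreTape _ (suc m) k → Maybe ℕ
  next zero    _    = nothing
  next (suc k) rest = coreLoop F pivot (suc m) k rest

-- random tape of one call of ApproxMCCore: iterations i = l, …, n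
CoreTapeFor : ℕ → ℕ → Set
CoreTapeFor n pivot = CoreTape n 0 (suc (n ∸ lOf pivot))

allCoreTapesFor : (n pivot : ℕ) → List (CoreTapeFor n pivot)
allCoreTapesFor n pivot = allCoreTapes n 0 (suc (n ∸ lOf pivot))

ApproxMCCore : ∀ {n} → CNF n → (pivot : ℕ) → CoreTapeFor n pivot → Maybe ℕ
ApproxMCCore {n} F pivot tape =
  let s = ∣BoundedSAT∣ (evalCNF F) (suc pivot) in
  if s ≤ᵇ pivot then just s else coreLoop F pivot 0 (n ∸ lOf pivot) tape

open Data.List.Sort ≤-decTotalOrder using (sort)

nth : List ℕ → ℕ → ℕ
nth []       _       = 0
nth (x ∷ xs) zero    = x
nth (x ∷ xs) (suc i) = nth xs i

median : List ℕ → Maybe ℚ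
median xs =
  let ys = sort xs
      k  = length ys in
  if k ≡ᵇ 0 then nothing
  else if k % 2 ≡ᵇ 0
    then just ((ℕ→ℚ (nth ys (k / 2 ∸ 1)) ℚ.+ ℕ→ℚ (nth ys (k / 2))) ℚ.* (ℚ._/_ (+ 1) 2))
    else just (ℕ→ℚ (nth ys (k / 2)))

ApproxMCTape : ℕ → ℕ → ℕ → Set
ApproxMCTape n pivot t = Vec (CoreTapeFor n pivot) t

allApproxMCTapes : (n pivot t : ℕ) → List (ApproxMCTape n pivot t)
allApproxMCTapes n pivot t = allVecsOf (allCoreTapesFor n pivot) t

ApproxMCRun : ∀ {n} → CNF n → (pivot t : ℕ) → ApproxMCTape n pivot t → Maybe ℚ
ApproxMCRun F pivot t tapes =
  median (catMaybes (Vec.toList (Vec.map (ApproxMCCore F pivot) tapes)))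

-- partial sums Σ_{i=0}^{N} 1/i! of e (increasing, with limit e)
expSum : ℕ → ℚ
expSum zero    = 1ℚ
expSum (suc N) = expSum N ℚ.+ ℚ._/_ (+ 1) (suc N !) {{suc N !≢0}}

-- for x > 0 and j ∈ ℕ:  3 e^{1/2} x ≤ j  ⇔  9 e x² ≤ j²  ⇔  ∀ N, 9 (Σ_{i≤N} 1/i!) x² ≤ j²
3√e*_≤_ : ℚ → ℕ → Set
3√e* x ≤ j = ∀ N → ℕ→ℚ 9 ℚ.* expSum N ℚ.* (x ℚ.* x) ≤ ℕ→ℚ (j ℕ.* j)

IsCeil3√e* : ℚ → ℕ → Set
IsCeil3√e* x k = 3√e* x ≤ k × (∀ j → 3√e* x ≤ j → k ℕ.≤ j)

1/pos : (ε : ℚ) → 0ℚ < ε → ℚ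
1/pos ε p = 1/_ ε {{ℚ.>-nonZero p}}

IsPivot : (ε : ℚ) → 0ℚ < ε → ℕ → Set
IsPivot ε p pivot =
  Data.Product.Σ ℕ (λ k → IsCeil3√e* ((1ℚ ℚ.+ 1/pos ε p) ^ℚ 2) k × pivot ≡ 2 ℕ.* k)
  where open import Relation.Binary.PropositionalEquality using (_≡_)

-- for δ > 0 and j ∈ ℕ:  35 log₂(3/δ) ≤ j  ⇔  (3/δ)^35 ≤ 2^j
35log₂3/_≤_ : (δ : ℚ) → 0ℚ < δ → ℕ → Set
35log₂3/_≤_ δ p j = (ℕ→ℚ 3 ℚ.* 1/pos δ p) ^ℚ 35 ≤ ℕ→ℚ (2 ℕ.^ j)

IsT : (δ : ℚ) → 0ℚ < δ → ℕ → Set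
IsT δ p t = 35log₂3/_≤_ δ p t × (∀ j → 35log₂3/_≤_ δ p j → t ℕ.≤ j)

1+ε>0 : (ε : ℚ) → 0ℚ < ε → 0ℚ < 1ℚ ℚ.+ ε
1+ε>0 ε p = +-mono-< (positive⁻¹ 1ℚ) p

inRange : (ε : ℚ) → 0ℚ < ε → (R : ℕ) → Maybe ℚ → Bool
inRange ε p R nothing  = false
inRange ε p R (just c) =
  does ((1/pos (1ℚ ℚ.+ ε) (1+ε>0 ε p) ℚ.* ℕ→ℚ R) ≤? c) ∧ does (c ≤? ((1ℚ ℚ.+ ε) ℚ.* ℕ→ℚ R))

-- Pr_{ω uniform in Ω}[E ω] ≥ q, written without division:
-- q · |Ω| ≤ #{ω ∈ Ω | E ω}
PrAtLeast : ∀ {A : Set} → (Ω : List A) → (A → Bool) → ℚ → Set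
PrAtLeast Ω E q = q ℚ.* ℕ→ℚ (length Ω) ≤ ℕ→ℚ (countTrue E Ω)

{-# OPTIONS --safe #-}

-- Fix an iteration with M = 2^m cells, write R = |R_F|, P = pivot, and let T = M |S| be the
-- estimate that it would return.  The xor hash family is pairwise independent, so T has mean R and
-- variance at most M R.  A bad T satisfies |T - R| ≥ β R with β = ε / (1 + ε), and P ≥ 6 √e / β²,
-- so by Chebyshev an iteration is bad with probability at most u = w P M / R, where w = 9/89 is a
-- rational upper bound of 1 / (6 √e).  From one iteration to the next u doubles.
--
-- The success probability of the remaining iterations is at least (3/5) / (1 - u).  Going
-- backwards this bound is preserved because (1 - u)² ≥ 1 - 2u.  It is established at the first
-- iteration with R / (P M) ≤ 4/3: there the next iteration, if it is reached, fails with
-- probability at most 2u, and the current one either is unlikely to be bad (when R / (P M) is not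
-- much smaller than 1) or is unlikely to overflow (when it is).
-- Hence one call of the core succeeds with probability at least 3/5.
--
-- If more than half of the t calls succeed then so does the median.  The exponential moment method
-- bounds the probability of the contrary by (49/50)^t, and 2 · 49^35 ≤ 50^35.
module Submission where

open import Defs
open import Data.Nat using (ℕ)
open import Data.Bool as Bool using (Bool; true; false; _∧_; _xor_; if_then_else_; not)
open import Data.Empty using (⊥; ⊥-elim)
open import Data.List as List using (List; []; _∷_; length; _++_; concatMap; cartesianProduct; catMaybes)
open import Data.Maybe using (Maybe; just; nothing; maybe′)
open import Data.Nat.Tactic.RingSolver using (solve-∀)
open import Data.Product using (_×_; _,_)
open import Data.Rational.Solver using (module +-*-Solver)
open import Data.Sum using (_⊎_; inj₁; inj₂)
open import Data.Unit using (tt)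
open import Data.Vec as Vec using (Vec; []; _∷_)
open import Function using (_∘_)
open import Relation.Binary.PropositionalEquality using (_≡_; refl; sym; trans; cong; cong₂; subst; module ≡-Reasoning)
open import Relation.Nullary using (Dec; yes; no; does)
open import Relation.Nullary.Decidable using (toWitness; dec-true)

-- The shape of the bound (3/5) / (1 - u) accounts for all earlier iterations at once. An iteration
-- with value u is preceded by iterations with values u/2, u/4, ..., which pass on at least the
-- fractions 1 - u/2, 1 - u/4, ... of the later successes, and the product of these fractions is at
-- least 1 - u. The target 3/5 is dictated by the 35 in t. With success probability p per call, the
-- exponential moment method gains a factor 2 √(p (1 - p)) per call; for small δ this must be at
-- most 2^(-1/35), about 0.9804, which requires p of about 0.5985. The slack is small, hence the
-- close rational approximations and the numerical thresholds. Within one iteration, overflow and a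
-- bad estimate are events of the same cell size and not independent. Failures are therefore bounded
-- pointwise by a constant plus a multiple of the squared deviation, and the variance is applied
-- once. Probabilities are counts of tapes with denominators cleared, so the analysis of the core
-- stays in ℕ.

module CoreAlgorithm where

  open import Data.List.Properties using (length-++; length-map)
  open import Data.Nat using (zero; suc; _+_; _*_; _∸_; _^_; _≤_; _<_; z≤n; s≤s; ∣_-_∣; _⊓_; _≤ᵇ_; NonZero; >-nonZero; ⌊_/2⌋; ⌈_/2⌉)
  open import Data.Nat.Logarithm using (⌊log₂_⌋; ⌊log₂⌊n/2⌋⌋≡⌊log₂n⌋∸1)
  open import Data.Nat.Logarithm.Core using (⌊log2⌋)
  open import Data.Nat.Properties
  open import Induction.WellFounded using (Acc; acc)

  ^-distribʳ-* : ∀ a b m → (a * b) ^ m ≡ a ^ m * b ^ m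
  ^-distribʳ-* a b zero    = refl
  ^-distribʳ-* a b (suc m) = trans (cong (a * b *_) (^-distribʳ-* a b m)) ([m*n]*[o*p]≡[m*o]*[n*p] a b (a ^ m) (b ^ m))

  -- Finite sums

  𝟙 : Bool → ℕ
  𝟙 b = if b then 1 else 0

  𝟙-∧ : ∀ a b → 𝟙 (a ∧ b) ≡ 𝟙 a * 𝟙 b
  𝟙-∧ true  b = sym (+-identityʳ _)
  𝟙-∧ false b = refl

  𝟙-not : ∀ b → 𝟙 (not b) + 𝟙 b ≡ 1
  𝟙-not true  = refl
  𝟙-not false = refl

  𝟙-idem : ∀ b → 𝟙 b * 𝟙 b ≡ 𝟙 b
  𝟙-idem true  = refl
  𝟙-idem false = refl

  ∑ : ∀ {A : Set} → List A → (A → ℕ) → ℕ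
  ∑ []       f = 0
  ∑ (x ∷ xs) f = f x + ∑ xs f

  module _ {A : Set} where

    ∑-cong : ∀ (xs : List A) {f g : A → ℕ} → (∀ x → f x ≡ g x) → ∑ xs f ≡ ∑ xs g
    ∑-cong []       f≡g = refl
    ∑-cong (x ∷ xs) f≡g = cong₂ _+_ (f≡g x) (∑-cong xs f≡g)

    ∑-mono : ∀ (xs : List A) {f g : A → ℕ} → (∀ x → f x ≤ g x) → ∑ xs f ≤ ∑ xs g
    ∑-mono []       f≤g = z≤n
    ∑-mono (x ∷ xs) f≤g = +-mono-≤ (f≤g x) (∑-mono xs f≤g)

    ∑-distrib-+ : ∀ (xs : List A) (f g : A → ℕ) → ∑ xs (λ x → f x + g x) ≡ ∑ xs f + ∑ xs g
    ∑-distrib-+ []       f g = refl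
    ∑-distrib-+ (x ∷ xs) f g = trans (cong (f x + g x +_) (∑-distrib-+ xs f g)) (interchange (f x) (g x) _ _)
      where
      interchange : ∀ a b c d → a + b + (c + d) ≡ a + c + (b + d)
      interchange = solve-∀

    ∑-*ʳ : ∀ (xs : List A) (f : A → ℕ) c → ∑ xs (λ x → f x * c) ≡ ∑ xs f * c
    ∑-*ʳ []       f c = refl
    ∑-*ʳ (x ∷ xs) f c = trans (cong (f x * c +_) (∑-*ʳ xs f c)) (sym (*-distribʳ-+ c (f x) _))

    ∑-*ˡ : ∀ (xs : List A) c (f : A → ℕ) → ∑ xs (λ x → c * f x) ≡ c * ∑ xs f
    ∑-*ˡ []       c f = sym (*-zeroʳ c)
    ∑-*ˡ (x ∷ xs) c f = trans (cong (c * f x +_) (∑-*ˡ xs c f)) (sym (*-distribˡ-+ c (f x) _))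

    ∑-const : ∀ (xs : List A) c → ∑ xs (λ _ → c) ≡ length xs * c
    ∑-const []       c = refl
    ∑-const (x ∷ xs) c = cong (c +_) (∑-const xs c)

    ∑-++ : ∀ (xs ys : List A) (f : A → ℕ) → ∑ (xs ++ ys) f ≡ ∑ xs f + ∑ ys f
    ∑-++ []       ys f = refl
    ∑-++ (x ∷ xs) ys f = trans (cong (f x +_) (∑-++ xs ys f)) (sym (+-assoc (f x) _ _))

    countTrue≡∑ : ∀ (p : A → Bool) xs → countTrue p xs ≡ ∑ xs (𝟙 ∘ p)
    countTrue≡∑ p []       = refl
    countTrue≡∑ p (x ∷ xs) with p x
    ... | true  = cong suc (countTrue≡∑ p xs)
    ... | false = countTrue≡∑ p xs

  module _ {A B : Set} where

    ∑-map : ∀ (g : A → B) xs (f : B → ℕ) → ∑ (List.map g xs) f ≡ ∑ xs (f ∘ g)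
    ∑-map g []       f = refl
    ∑-map g (x ∷ xs) f = cong (f (g x) +_) (∑-map g xs f)

    ∑-concatMap : ∀ (g : A → List B) xs (f : B → ℕ) → ∑ (concatMap g xs) f ≡ ∑ xs (λ x → ∑ (g x) f)
    ∑-concatMap g []       f = refl
    ∑-concatMap g (x ∷ xs) f = trans (∑-++ (g x) (concatMap g xs) f) (cong (∑ (g x) f +_) (∑-concatMap g xs f))

  module _ {A B : Set} where

    ∑-cartesianProduct : ∀ (xs : List A) (ys : List B) (f : A × B → ℕ) →
      ∑ (cartesianProduct xs ys) f ≡ ∑ xs (λ x → ∑ ys (λ y → f (x , y)))
    ∑-cartesianProduct []       ys f = refl
    ∑-cartesianProduct (x ∷ xs) ys f =
      trans (∑-++ (List.map (x ,_) ys) _ f) (cong₂ _+_ (∑-map (x ,_) ys f) (∑-cartesianProduct xs ys f))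

    ∑-comm : ∀ (xs : List A) (ys : List B) (f : A → B → ℕ) →
      ∑ xs (λ x → ∑ ys (f x)) ≡ ∑ ys (λ y → ∑ xs (λ x → f x y))
    ∑-comm []       ys f = sym (trans (∑-const ys 0) (*-zeroʳ (length ys)))
    ∑-comm (x ∷ xs) ys f = trans (cong (∑ ys (f x) +_) (∑-comm xs ys f)) (sym (∑-distrib-+ ys (f x) _))

    ∑-*-∑ : ∀ (xs : List A) (ys : List B) (f : A → ℕ) (g : B → ℕ) →
      ∑ xs (λ x → ∑ ys (λ y → f x * g y)) ≡ ∑ xs f * ∑ ys g
    ∑-*-∑ xs ys f g = trans (∑-cong xs (λ x → ∑-*ˡ ys (f x) g)) (∑-*ʳ xs f (∑ ys g))

    length-cartesianProduct : ∀ (xs : List A) (ys : List B) → length (cartesianProduct xs ys) ≡ length xs * length ys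
    length-cartesianProduct []       ys = refl
    length-cartesianProduct (x ∷ xs) ys =
      trans (length-++ (List.map (x ,_) ys)) (cong₂ _+_ (length-map (x ,_) ys) (length-cartesianProduct xs ys))

  length≡∑ : ∀ {A : Set} (xs : List A) → length xs ≡ ∑ xs (λ _ → 1)
  length≡∑ xs = sym (trans (∑-const xs 1) (*-identityʳ _))

  ∑-allVecsOf : ∀ {A : Set} (xs : List A) m (f : Vec A (suc m) → ℕ) →
    ∑ (allVecsOf xs (suc m)) f ≡ ∑ xs (λ x → ∑ (allVecsOf xs m) (λ v → f (x ∷ v)))
  ∑-allVecsOf xs m f = trans (∑-concatMap _ xs f) (∑-cong xs (λ x → ∑-map (x ∷_) (allVecsOf xs m) f))

  bits : List Bool
  bits = false ∷ true ∷ []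

  -- Pairwise independence of the xor hash family

  private
    dot : ∀ {n} → Vec Bool n → Vec Bool n → Bool
    dot a y = Vec.foldr _ _xor_ false (Vec.zipWith _∧_ a y)

    agree : ∀ {n} → (y z : Vec Bool n) → ℕ
    agree {n} y z = ∑ (allAssignments n) (λ a → 𝟙 (not (dot a y xor dot a z)))

    disagree : ∀ {n} → (y z : Vec Bool n) → ℕ
    disagree {n} y z = ∑ (allAssignments n) (λ a → 𝟙 (dot a y xor dot a z))

  agree+disagree : ∀ {n} (y z : Vec Bool n) → agree y z + disagree y z ≡ length (allAssignments n)
  agree+disagree {n} y z =
    trans (sym (∑-distrib-+ (allAssignments n) _ _))
          (trans (∑-cong (allAssignments n) (λ a → 𝟙-not (dot a y xor dot a z))) (sym (length≡∑ (allAssignments n))))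

  xor-same : ∀ a → a xor a ≡ false
  xor-same true  = refl
  xor-same false = refl

  agree-refl : ∀ {n} (y : Vec Bool n) → agree y y ≡ length (allAssignments n)
  agree-refl {n} y = trans (∑-cong (allAssignments n) (λ a → cong (𝟙 ∘ not) (xor-same (dot a y)))) (sym (length≡∑ (allAssignments n)))

  private
    xor-tt : ∀ a b → (not a) xor (not b) ≡ a xor b
    xor-tt true  true  = refl
    xor-tt true  false = refl
    xor-tt false true  = refl
    xor-tt false false = refl

    xor-tf : ∀ a b → (not a) xor b ≡ not (a xor b)
    xor-tf true  true  = refl
    xor-tf true  false = refl
    xor-tf false true  = refl
    xor-tf false false = refl

    xor-ft : ∀ a b → a xor (not b) ≡ not (a xor b)
    xor-ft true  true  = refl
    xor-ft true  false = refl
    xor-ft false true  = refl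
    xor-ft false false = refl

    notnot : ∀ a → not (not a) ≡ a
    notnot true  = refl
    notnot false = refl

    ∑-bits : ∀ n (f : Vec Bool (suc n) → ℕ) →
      ∑ (allAssignments (suc n)) f ≡ ∑ (allAssignments n) (f ∘ (false ∷_)) + ∑ (allAssignments n) (f ∘ (true ∷_))
    ∑-bits n f = trans (∑-allVecsOf bits n f) (cong (∑ (allAssignments n) (f ∘ (false ∷_)) +_) (+-identityʳ _))

  -- Equal first bits double both counts; different first bits make the bit a₁ swap agreement and disagreement.
  agree≡disagree : ∀ {n} (y z : Vec Bool n) → eqBits y z ≡ false → agree y z ≡ disagree y z
  agree≡disagree []          []          ()
  agree≡disagree {suc n} (false ∷ y) (false ∷ z) y≢z =
    trans (∑-bits n _) (trans (cong₂ _+_ (agree≡disagree y z y≢z) (agree≡disagree y z y≢z)) (sym (∑-bits n _)))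
  agree≡disagree {suc n} (true ∷ y) (true ∷ z) y≢z =
    trans (∑-bits n _) (trans
      (cong₂ _+_ (agree≡disagree y z y≢z)
        (trans (∑-cong (allAssignments n) (λ a → cong (𝟙 ∘ not) (xor-tt (dot a y) (dot a z))))
          (trans (agree≡disagree y z y≢z) (sym (∑-cong (allAssignments n) (λ a → cong 𝟙 (xor-tt (dot a y) (dot a z))))))))
      (sym (∑-bits n _)))
  agree≡disagree {suc n} (false ∷ y) (true ∷ z) _ =
    trans (∑-bits n _) (trans
      (cong₂ _+_ {agree y z} {_} {_} {disagree y z} refl
        (∑-cong (allAssignments n) (λ a → cong 𝟙 (trans (cong not (xor-ft (dot a y) (dot a z))) (notnot _)))))
      (trans (+-comm (agree y z) (disagree y z))
        (trans (cong (disagree y z +_) (∑-cong (allAssignments n) (λ a → sym (cong 𝟙 (xor-ft (dot a y) (dot a z))))))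
        (sym (∑-bits n _)))))
  agree≡disagree {suc n} (true ∷ y) (false ∷ z) _ =
    trans (∑-bits n _) (trans
      (cong₂ _+_ {agree y z} {_} {_} {disagree y z} refl
        (∑-cong (allAssignments n) (λ a → cong 𝟙 (trans (cong not (xor-tf (dot a y) (dot a z))) (notnot _)))))
      (trans (+-comm (agree y z) (disagree y z))
        (trans (cong (disagree y z +_) (∑-cong (allAssignments n) (λ a → sym (cong 𝟙 (xor-tf (dot a y) (dot a z))))))
        (sym (∑-bits n _)))))

  hits : ∀ {n m} → HashStep n m → Vec Bool n → ℕ
  hits (h , α) y = 𝟙 (eqBits (applyHash h y) α)

  private
    rowHits : ∀ {n} → HashRow n → Bool → Vec Bool n → ℕ
    rowHits r b y = 𝟙 (not (applyRow r y xor b))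

    rowCollisions : ∀ {n} → (y z : Vec Bool n) → ℕ
    rowCollisions {n} y z = ∑ (allHashRows n) (λ r → ∑ bits (λ b → rowHits r b y * rowHits r b z))

    xor-cancelˡ : ∀ a c d → (a xor c) xor (a xor d) ≡ c xor d
    xor-cancelˡ false c d = refl
    xor-cancelˡ true  c d = xor-tt c d

    collide-bits : ∀ c d → ∑ bits (λ b → 𝟙 (not (c xor b)) * 𝟙 (not (d xor b))) ≡ 𝟙 (not (c xor d))
    collide-bits true  true  = refl
    collide-bits true  false = refl
    collide-bits false true  = refl
    collide-bits false false = refl

    -- A row that sends y and z to the same bit hits both for exactly one b, any other row for none.
    -- The coefficient a₀ cancels in the comparison and contributes only the factor 2.
    rowCollisions≡agree : ∀ {n} (y z : Vec Bool n) → rowCollisions y z ≡ 2 * agree y z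
    rowCollisions≡agree {n} y z =
      trans (∑-cartesianProduct bits (allAssignments n) _)
        (∑-cong bits (λ a₀ → ∑-cong (allAssignments n) (λ a →
           trans (collide-bits (applyRow (a₀ , a) y) (applyRow (a₀ , a) z)) (cong (𝟙 ∘ not) (xor-cancelˡ a₀ (dot a y) (dot a z))))))

    length-rows : ∀ n → length (allHashRows n) ≡ 2 * length (allAssignments n)
    length-rows n = length-cartesianProduct bits (allAssignments n)

    rowCollisions-refl : ∀ {n} (y : Vec Bool n) → rowCollisions y y * 2 ≡ length (allHashRows n) * 2
    rowCollisions-refl {n} y = cong (_* 2) (trans (rowCollisions≡agree y y) (trans (cong (2 *_) (agree-refl y)) (sym (length-rows n))))

    rowCollisions-≢ : ∀ {n} (y z : Vec Bool n) → eqBits y z ≡ false → rowCollisions y z * 4 ≡ length (allHashRows n) * 2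
    rowCollisions-≢ {n} y z y≢z = begin
      rowCollisions y z * 4             ≡⟨ cong (_* 4) (rowCollisions≡agree y z) ⟩
      2 * agree y z * 4                 ≡⟨ double (agree y z) ⟩
      2 * (agree y z + agree y z) * 2   ≡⟨ cong (λ c → 2 * (agree y z + c) * 2) (agree≡disagree y z y≢z) ⟩
      2 * (agree y z + disagree y z) * 2 ≡⟨ cong (λ c → 2 * c * 2) (agree+disagree y z) ⟩
      2 * length (allAssignments n) * 2 ≡⟨ cong (_* 2) (sym (length-rows n)) ⟩
      length (allHashRows n) * 2        ∎
      where
      open ≡-Reasoning
      double : ∀ a → 2 * a * 4 ≡ 2 * (a + a) * 2
      double = solve-∀

  -- Independence of the rows: a product weight splits off the first row together with its target
  -- bit, although the list pairs whole hashes with whole targets.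
  ∑-allHashSteps : ∀ n m (f : HashRow n → Bool → ℕ) (g : HashStep n m → ℕ) →
    ∑ (allHashSteps n (suc m)) (λ { (r ∷ h , b ∷ α) → f r b * g (h , α) })
      ≡ ∑ (allHashRows n) (λ r → ∑ bits (f r)) * ∑ (allHashSteps n m) g
  ∑-allHashSteps n m f g = begin
    ∑ (allHashSteps n (suc m)) _
      ≡⟨ ∑-cartesianProduct (allVecsOf (allHashRows n) (suc m)) (allAssignments (suc m)) _ ⟩
    ∑ (allVecsOf rows (suc m)) (λ h → ∑ (allAssignments (suc m)) _)
      ≡⟨ ∑-allVecsOf rows m _ ⟩
    ∑ rows (λ r → ∑ hs (λ h → ∑ (allAssignments (suc m)) _))
      ≡⟨ ∑-cong rows (λ r → ∑-cong hs (λ h → ∑-allVecsOf bits m _)) ⟩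
    ∑ rows (λ r → ∑ hs (λ h → ∑ bits (λ b → ∑ αs (λ α → f r b * g (h , α)))))
      ≡⟨ ∑-cong rows (λ r → ∑-cong hs (λ h → ∑-*-∑ bits αs (f r) (λ α → g (h , α)))) ⟩
    ∑ rows (λ r → ∑ hs (λ h → ∑ bits (f r) * ∑ αs (λ α → g (h , α))))
      ≡⟨ ∑-*-∑ rows hs (λ r → ∑ bits (f r)) (λ h → ∑ αs (λ α → g (h , α))) ⟩
    ∑ rows (λ r → ∑ bits (f r)) * ∑ hs (λ h → ∑ αs (λ α → g (h , α)))
      ≡⟨ cong (∑ rows (λ r → ∑ bits (f r)) *_) (sym (∑-cartesianProduct hs αs g)) ⟩
    ∑ rows (λ r → ∑ bits (f r)) * ∑ (allHashSteps n m) g ∎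
    where
    open ≡-Reasoning
    rows = allHashRows n
    hs = allVecsOf rows m
    αs = allAssignments m

  private
    ∑-steps-cong : ∀ n m {f g : HashStep n (suc m) → ℕ} →
      (∀ r h b α → f (r ∷ h , b ∷ α) ≡ g (r ∷ h , b ∷ α)) → ∑ (allHashSteps n (suc m)) f ≡ ∑ (allHashSteps n (suc m)) g
    ∑-steps-cong n m f≡g = ∑-cong (allHashSteps n (suc m)) (λ { (r ∷ h , b ∷ α) → f≡g r h b α })

    length-steps : ∀ n m → length (allHashSteps n (suc m)) ≡ length (allHashRows n) * 2 * length (allHashSteps n m)
    length-steps n m = begin
      length (allHashSteps n (suc m))      ≡⟨ length≡∑ (allHashSteps n (suc m)) ⟩
      -- The constant function and the matching lambda in `∑-allHashSteps` agree only pointwise.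
      ∑ (allHashSteps n (suc m)) (λ _ → 1) ≡⟨ ∑-steps-cong n m (λ r h b α → refl) ⟩
      ∑ (allHashSteps n (suc m)) _         ≡⟨ ∑-allHashSteps n m (λ _ _ → 1) (λ _ → 1) ⟩
      ∑ (allHashRows n) (λ r → 2) * ∑ (allHashSteps n m) (λ _ → 1)
        ≡⟨ cong₂ _*_ (∑-const (allHashRows n) 2) (sym (length≡∑ (allHashSteps n m))) ⟩
      length (allHashRows n) * 2 * length (allHashSteps n m) ∎
      where open ≡-Reasoning

  collisions : ∀ {n} m → (y z : Vec Bool n) → ℕ
  collisions {n} m y z = ∑ (allHashSteps n m) (λ s → hits s y * hits s z)

  private
    collisions-suc : ∀ {n} m (y z : Vec Bool n) → collisions (suc m) y z ≡ rowCollisions y z * collisions m y z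
    collisions-suc {n} m y z =
      trans (∑-steps-cong n m (λ r h b α →
               trans (cong₂ _*_ (𝟙-∧ (not (applyRow r y xor b)) _) (𝟙-∧ (not (applyRow r z xor b)) _))
                     ([m*n]*[o*p]≡[m*o]*[n*p] (rowHits r b y) _ (rowHits r b z) _)))
            (∑-allHashSteps n m (λ r b → rowHits r b y * rowHits r b z) (λ s → hits s y * hits s z))

    -- 1 / c is the probability that one row with its target bit hits both points: c is 2 for equal
    -- points and 4 for different ones. Independent rows give the power c ^ m.
    collisions-ratio : ∀ {n} (y z : Vec Bool n) c → rowCollisions y z * c ≡ length (allHashRows n) * 2 →
      ∀ m → collisions m y z * c ^ m ≡ length (allHashSteps n m)
    collisions-ratio y z c eq zero    = refl
    collisions-ratio {n} y z c eq (suc m) = begin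
      collisions (suc m) y z * (c * c ^ m)                ≡⟨ cong (_* (c * c ^ m)) (collisions-suc m y z) ⟩
      rowCollisions y z * collisions m y z * (c * c ^ m)  ≡⟨ [m*n]*[o*p]≡[m*o]*[n*p] (rowCollisions y z) (collisions m y z) c (c ^ m) ⟩
      rowCollisions y z * c * (collisions m y z * c ^ m)  ≡⟨ cong₂ _*_ eq (collisions-ratio y z c eq m) ⟩
      length (allHashRows n) * 2 * length (allHashSteps n m) ≡⟨ sym (length-steps n m) ⟩
      length (allHashSteps n (suc m))                     ∎
      where
      open ≡-Reasoning

  -- Hitting y is a collision of y with itself, because indicators are idempotent.
  hits-uniform : ∀ {n} m (y : Vec Bool n) → ∑ (allHashSteps n m) (λ s → hits s y) * 2 ^ m ≡ length (allHashSteps n m)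
  hits-uniform {n} m y =
    trans (cong (_* 2 ^ m) (∑-cong (allHashSteps n m) (λ { (h , α) → sym (𝟙-idem (eqBits (applyHash h y) α)) })))
          (collisions-ratio y y 2 (rowCollisions-refl y) m)

  private
    eqBits⇒≡ : ∀ {n} (y z : Vec Bool n) → eqBits y z ≡ true → y ≡ z
    eqBits⇒≡ []          []          _ = refl
    eqBits⇒≡ (true ∷ y)  (true ∷ z)  p = cong (true ∷_) (eqBits⇒≡ y z p)
    eqBits⇒≡ (false ∷ y) (false ∷ z) p = cong (false ∷_) (eqBits⇒≡ y z p)


  -- One formula for both cases lets the double sum over solutions split: the first summand yields
  -- R² and the diagonal yields M R. For different points the first summand is the exact value, for
  -- equal points the second.
  collisions-≤ : ∀ {n} m (y z : Vec Bool n) → collisions m y z * (2 ^ m * 2 ^ m) ≤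
    length (allHashSteps n m) + length (allHashSteps n m) * 2 ^ m * 𝟙 (eqBits y z)
  collisions-≤ {n} m y z with eqBits y z in eq
  ... | false = ≤-trans (≤-reflexive (trans (cong (collisions m y z *_) (sym (^-distribʳ-* 2 2 m)))
                   (collisions-ratio y z 4 (rowCollisions-≢ y z eq) m))) (m≤m+n _ _)
  ... | true with eqBits⇒≡ y z eq
  ...   | refl = ≤-trans (≤-reflexive (trans (sym (*-assoc (collisions m y y) (2 ^ m) (2 ^ m)))
                   (trans (cong (_* 2 ^ m) (collisions-ratio y y 2 (rowCollisions-refl y) m)) (sym (*-identityʳ _))))) (m≤n+m _ _)

  private
    ∑-diagonal : ∀ n (z : Vec Bool n) (f : Vec Bool n → ℕ) → ∑ (allAssignments n) (λ y → f y * 𝟙 (eqBits z y)) ≡ f z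
    ∑-diagonal zero    []          f = trans (+-identityʳ _) (*-identityʳ _)
    ∑-diagonal (suc n) (false ∷ z) f = trans (∑-bits n _)
      (trans (cong₂ _+_ (∑-diagonal n z (f ∘ (false ∷_)))
         (trans (∑-cong (allAssignments n) (λ y → *-zeroʳ (f (true ∷ y)))) (trans (∑-const (allAssignments n) 0) (*-zeroʳ (length (allAssignments n)))))) (+-identityʳ _))
    ∑-diagonal (suc n) (true ∷ z)  f = trans (∑-bits n _)
      (cong₂ _+_ (trans (∑-cong (allAssignments n) (λ y → *-zeroʳ (f (false ∷ y)))) (trans (∑-const (allAssignments n) 0) (*-zeroʳ (length (allAssignments n)))))
         (∑-diagonal n z (f ∘ (true ∷_))))

  -- Mean and variance of the estimate

  cellSize : ∀ {n m} → (Vec Bool n → Bool) → HashStep n m → ℕ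
  cellSize φ (h , α) = #sat (λ y → φ y ∧ eqBits (applyHash h y) α)

  module _ {n : ℕ} (φ : Vec Bool n → Bool) (m : ℕ) where
    private
      ys = allAssignments n
      steps = allHashSteps n m
      N = length steps
      M = 2 ^ m
      R = #sat φ
      χ : Vec Bool n → ℕ
      χ = 𝟙 ∘ φ

      R≡∑ : R ≡ ∑ ys χ
      R≡∑ = countTrue≡∑ φ ys

      cellSize≡∑ : ∀ (s : HashStep n m) → cellSize φ s ≡ ∑ ys (λ y → χ y * hits s y)
      cellSize≡∑ (h , α) = trans (countTrue≡∑ _ ys) (∑-cong ys (λ y → 𝟙-∧ (φ y) _))

    cellSize-mean : ∑ steps (cellSize φ) * M ≡ N * R
    cellSize-mean = begin
      ∑ steps (cellSize φ) * M               ≡⟨ cong (_* M) (∑-cong steps cellSize≡∑) ⟩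
      ∑ steps (λ s → ∑ ys (λ y → χ y * hits s y)) * M ≡⟨ cong (_* M) (∑-comm steps ys _) ⟩
      ∑ ys (λ y → ∑ steps (λ s → χ y * hits s y)) * M ≡⟨ sym (∑-*ʳ ys _ M) ⟩
      ∑ ys (λ y → ∑ steps (λ s → χ y * hits s y) * M)
        ≡⟨ ∑-cong ys (λ y → trans (cong (_* M) (∑-*ˡ steps (χ y) _))
             (trans (*-assoc (χ y) _ M) (cong (χ y *_) (hits-uniform m y)))) ⟩
      ∑ ys (λ y → χ y * N)                           ≡⟨ ∑-*ʳ ys χ N ⟩
      ∑ ys χ * N                                     ≡⟨ cong (_* N) (sym R≡∑) ⟩
      R * N                                          ≡⟨ *-comm R N ⟩
      N * R                                          ∎
      where open ≡-Reasoning

    private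
      square : ∀ (s : HashStep n m) → cellSize φ s * cellSize φ s ≡ ∑ ys (λ y → ∑ ys (λ z → χ y * χ z * (hits s y * hits s z)))
      square s = begin
        cellSize φ s * cellSize φ s ≡⟨ cong₂ _*_ (cellSize≡∑ s) (cellSize≡∑ s) ⟩
        ∑ ys (λ y → χ y * hits s y) * ∑ ys (λ z → χ z * hits s z)
          ≡⟨ sym (∑-*-∑ ys ys _ _) ⟩
        ∑ ys (λ y → ∑ ys (λ z → χ y * hits s y * (χ z * hits s z)))
          ≡⟨ ∑-cong ys (λ y → ∑-cong ys (λ z → [m*n]*[o*p]≡[m*o]*[n*p] (χ y) (hits s y) (χ z) (hits s z))) ⟩
        ∑ ys (λ y → ∑ ys (λ z → χ y * χ z * (hits s y * hits s z))) ∎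
        where
        open ≡-Reasoning

      pairTerm : ∀ y z → ∑ steps (λ s → χ y * χ z * (hits s y * hits s z)) * (M * M) ≤ χ y * (χ z * N + χ z * (N * M) * 𝟙 (eqBits y z))
      pairTerm y z = begin
        ∑ steps (λ s → χ y * χ z * (hits s y * hits s z)) * (M * M)
          ≡⟨ cong (_* (M * M)) (∑-*ˡ steps (χ y * χ z) _) ⟩
        χ y * χ z * collisions m y z * (M * M) ≡⟨ *-assoc (χ y * χ z) _ _ ⟩
        χ y * χ z * (collisions m y z * (M * M)) ≤⟨ *-monoʳ-≤ (χ y * χ z) (collisions-≤ m y z) ⟩
        χ y * χ z * (N + N * M * 𝟙 (eqBits y z)) ≡⟨ distribute (χ y) (χ z) N (N * M) (𝟙 (eqBits y z)) ⟩
        χ y * (χ z * N + χ z * (N * M) * 𝟙 (eqBits y z)) ∎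
        where
        open ≤-Reasoning
        distribute : ∀ a b c d e → a * b * (c + d * e) ≡ a * (b * c + b * d * e)
        distribute = solve-∀

    cellSize-secondMoment : ∑ steps (λ s → cellSize φ s * cellSize φ s) * (M * M) ≤ N * (R * R + M * R)
    cellSize-secondMoment = begin
      ∑ steps (λ s → cellSize φ s * cellSize φ s) * (M * M)
        ≡⟨ cong (_* (M * M)) (∑-cong steps square) ⟩
      ∑ steps (λ s → ∑ ys (λ y → ∑ ys (λ z → χ y * χ z * (hits s y * hits s z)))) * (M * M)
        ≡⟨ cong (_* (M * M)) (trans (∑-comm steps ys _) (∑-cong ys (λ y → ∑-comm steps ys _))) ⟩
      ∑ ys (λ y → ∑ ys (λ z → ∑ steps (λ s → χ y * χ z * (hits s y * hits s z)))) * (M * M)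
        ≡⟨ trans (sym (∑-*ʳ ys _ (M * M))) (∑-cong ys (λ y → sym (∑-*ʳ ys _ (M * M)))) ⟩
      ∑ ys (λ y → ∑ ys (λ z → ∑ steps (λ s → χ y * χ z * (hits s y * hits s z)) * (M * M)))
        ≤⟨ ∑-mono ys (λ y → ∑-mono ys (pairTerm y)) ⟩
      ∑ ys (λ y → ∑ ys (λ z → χ y * (χ z * N + χ z * (N * M) * 𝟙 (eqBits y z))))
        ≡⟨ ∑-cong ys (λ y → trans (∑-*ˡ ys (χ y) _) (cong (χ y *_)
             (trans (∑-distrib-+ ys _ _) (cong₂ _+_ (∑-*ʳ ys χ N) (∑-diagonal n y (λ z → χ z * (N * M))))))) ⟩
      ∑ ys (λ y → χ y * (∑ ys χ * N + χ y * (N * M)))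
        ≡⟨ ∑-cong ys (λ y → trans (*-distribˡ-+ (χ y) (∑ ys χ * N) _) (cong (χ y * (∑ ys χ * N) +_)
              (trans (sym (*-assoc (χ y) (χ y) _)) (cong (_* (N * M)) (𝟙-idem (φ y)))))) ⟩
      ∑ ys (λ y → χ y * (∑ ys χ * N) + χ y * (N * M))
        ≡⟨ trans (∑-distrib-+ ys _ _) (cong₂ _+_ (∑-*ʳ ys χ _) (∑-*ʳ ys χ _)) ⟩
      ∑ ys χ * (∑ ys χ * N) + ∑ ys χ * (N * M) ≡⟨ cong (λ r → r * (r * N) + r * (N * M)) (sym R≡∑) ⟩
      R * (R * N) + R * (N * M) ≡⟨ collect R N M ⟩
      N * (R * R + M * R) ∎
      where
      open ≤-Reasoning
      collect : ∀ r n m → r * (r * n) + r * (n * m) ≡ n * (r * r + m * r)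
      collect = solve-∀

  -- The binomial formula with its cross term moved to the left, so that a squared deviation can be
  -- expanded in ℕ without knowing which side is larger.
  ∣m-n∣²+2mn : ∀ a b → ∣ a - b ∣ * ∣ a - b ∣ + 2 * (a * b) ≡ a * a + b * b
  ∣m-n∣²+2mn zero    b = +-identityʳ (b * b)
  ∣m-n∣²+2mn (suc a) zero = solve₀ a
    where
    solve₀ : ∀ a → suc a * suc a + 2 * (suc a * 0) ≡ suc a * suc a + 0
    solve₀ = solve-∀
  ∣m-n∣²+2mn (suc a) (suc b) = begin
    d * d + 2 * (suc a * suc b)               ≡⟨ expand d a b ⟩
    (d * d + 2 * (a * b)) + 2 * (1 + a + b)   ≡⟨ cong (_+ 2 * (1 + a + b)) (∣m-n∣²+2mn a b) ⟩
    (a * a + b * b) + 2 * (1 + a + b)         ≡⟨ contract a b ⟩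
    suc a * suc a + suc b * suc b             ∎
    where
    open ≡-Reasoning
    d = ∣ a - b ∣
    expand : ∀ d a b → d * d + 2 * (suc a * suc b) ≡ (d * d + 2 * (a * b)) + 2 * (1 + a + b)
    expand = solve-∀
    contract : ∀ a b → (a * a + b * b) + 2 * (1 + a + b) ≡ suc a * suc a + suc b * suc b
    contract = solve-∀

  -- Measured on the estimate and not on the cell size, so that the mean is the integer R for every
  -- m.
  deviation : ∀ {n m} → (Vec Bool n → Bool) → HashStep n m → ℕ
  deviation {m = m} φ s = ∣ cellSize φ s * 2 ^ m - #sat φ ∣

  cellSize-variance : ∀ {n} (φ : Vec Bool n → Bool) m →
    ∑ (allHashSteps n m) (λ s → deviation φ s * deviation φ s) ≤ length (allHashSteps n m) * (2 ^ m * #sat φ)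
  -- Adding 2 N R² to both sides avoids subtraction. By the mean, this is the sum of the cross terms
  -- 2 T R, which complete each squared deviation to T² + R².
  cellSize-variance {n} φ m = +-cancelʳ-≤ (2 * (N * (R * R))) _ _ (begin
    ∑ steps (λ s → deviation φ s * deviation φ s) + 2 * (N * (R * R))
      ≡⟨ cong (∑ steps (λ s → deviation φ s * deviation φ s) +_) cross ⟩
    ∑ steps (λ s → deviation φ s * deviation φ s) + ∑ steps (λ s → 2 * (T s * R))
      ≡⟨ sym (∑-distrib-+ steps _ _) ⟩
    ∑ steps (λ s → deviation φ s * deviation φ s + 2 * (T s * R))
      ≡⟨ ∑-cong steps (λ s → ∣m-n∣²+2mn (T s) R) ⟩
    ∑ steps (λ s → T s * T s + R * R)
      ≡⟨ trans (∑-distrib-+ steps _ _) (cong₂ _+_ squares (∑-const steps (R * R))) ⟩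
    ∑ steps (λ s → cellSize φ s * cellSize φ s) * (M * M) + N * (R * R)
      ≤⟨ +-monoˡ-≤ (N * (R * R)) (cellSize-secondMoment φ m) ⟩
    N * (R * R + M * R) + N * (R * R) ≡⟨ collect N R (M * R) ⟩
    N * (M * R) + 2 * (N * (R * R)) ∎)
    where
    open ≤-Reasoning
    steps = allHashSteps n m
    N = length steps
    M = 2 ^ m
    R = #sat φ
    T : HashStep n m → ℕ
    T s = cellSize φ s * M
    collect : ∀ n r x → n * (r * r + x) + n * (r * r) ≡ n * x + 2 * (n * (r * r))
    collect = solve-∀
    assoc₃ : ∀ a b c → 2 * (a * b * c) ≡ a * (b * (2 * c))
    assoc₃ = solve-∀
    regroup : ∀ a b c → a * (b * (2 * c)) ≡ 2 * ((a * b) * c)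
    regroup = solve-∀
    squares : ∑ steps (λ s → T s * T s) ≡ ∑ steps (λ s → cellSize φ s * cellSize φ s) * (M * M)
    squares = trans (∑-cong steps (λ s → [m*n]*[o*p]≡[m*o]*[n*p] (cellSize φ s) M (cellSize φ s) M)) (∑-*ʳ steps _ (M * M))
    cross : 2 * (N * (R * R)) ≡ ∑ steps (λ s → 2 * (T s * R))
    cross = sym (trans (∑-cong steps (λ s → assoc₃ (cellSize φ s) M R))
      (trans (∑-*ʳ steps (cellSize φ) (M * (2 * R)))
      (trans (regroup (∑ steps (cellSize φ)) M R)
        (cong (2 *_) (trans (cong (_* R) (cellSize-mean φ m)) (*-assoc N R R))))))

  -- Arithmetic of the success bound

  -- d = 89 R and v = 9 P M measure the failure probability v / d of a single
  -- iteration; L' = F' + S' and N * L' = F + S count the tapes of the remaining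
  -- iterations and of all iterations.

  remaining-success : ∀ {d v e N F' S' F S} → d ≡ v + e → F + S ≡ N * (F' + S') →
    F * d ≤ N * (F' * d + v * S') → N * S' * e ≤ S * d
  remaining-success {d} {v} {e} {N} {F'} {S'} {F} {S} d≡v+e F+S≡ Fd≤ = +-cancelˡ-≤ (N * (F' * d + v * S')) _ _ (begin
    N * (F' * d + v * S') + N * S' * e ≡⟨ collect N F' d v S' e ⟩
    N * (F' * d) + N * S' * (v + e)    ≡⟨ cong (λ w → N * (F' * d) + N * S' * w) (sym d≡v+e) ⟩
    N * (F' * d) + N * S' * d          ≡⟨ factor N F' d S' ⟩
    N * (F' + S') * d                  ≡⟨ cong (_* d) (sym F+S≡) ⟩
    (F + S) * d                        ≡⟨ *-distribʳ-+ d F S ⟩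
    F * d + S * d                      ≤⟨ +-monoˡ-≤ (S * d) Fd≤ ⟩
    N * (F' * d + v * S') + S * d      ∎)
    where
    open ≤-Reasoning
    collect : ∀ N F' d v S' e → N * (F' * d + v * S') + N * S' * e ≡ N * (F' * d) + N * S' * (v + e)
    collect = solve-∀
    factor : ∀ N F' d S' → N * (F' * d) + N * S' * d ≡ N * (F' + S') * d
    factor = solve-∀

  -- (1 - u) · 3/5 / (1 - 2u) ≥ 3/5 / (1 - u) for u = v / d, because (1 - u)² ≥ 1 - 2u.
  invariant-step : ∀ {d v e N L' S' S} .{{_ : NonZero d}} → d ≡ v + (v + e) →
    N * S' * (v + e) ≤ S * d → 3 * d * L' ≤ 5 * S' * e → 3 * d * (N * L') ≤ 5 * S * (v + e)
  invariant-step {d} {v} {e} {N} {L'} {S'} {S} d≡ NS'≤ IH = *-cancelˡ-≤ d (begin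
    d * (3 * d * (N * L'))            ≡⟨ regroup₁ d N L' ⟩
    d * N * (3 * d * L')              ≤⟨ *-monoʳ-≤ (d * N) IH ⟩
    d * N * (5 * S' * e)              ≡⟨ regroup₂ d N S' e ⟩
    5 * N * S' * (d * e)              ≡⟨ cong (λ w → 5 * N * S' * (w * e)) d≡ ⟩
    5 * N * S' * ((v + (v + e)) * e)  ≤⟨ *-monoʳ-≤ (5 * N * S') (≤-trans (m≤m+n _ (v * v)) (≤-reflexive (complete v e))) ⟩
    5 * N * S' * ((v + e) * (v + e))  ≡⟨ regroup₃ N S' (v + e) ⟩
    5 * (v + e) * (N * S' * (v + e))  ≤⟨ *-monoʳ-≤ (5 * (v + e)) NS'≤ ⟩
    5 * (v + e) * (S * d)             ≡⟨ regroup₄ (v + e) S d ⟩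
    d * (5 * S * (v + e))             ∎)
    where
    open ≤-Reasoning
    regroup₁ : ∀ d N L → d * (3 * d * (N * L)) ≡ d * N * (3 * d * L)
    regroup₁ = solve-∀
    regroup₂ : ∀ d N S e → d * N * (5 * S * e) ≡ 5 * N * S * (d * e)
    regroup₂ = solve-∀
    regroup₃ : ∀ N S c → 5 * N * S * (c * c) ≡ 5 * c * (N * S * c)
    regroup₃ = solve-∀
    regroup₄ : ∀ c S d → 5 * c * (S * d) ≡ d * (5 * S * c)
    regroup₄ = solve-∀
    complete : ∀ v e → (v + (v + e)) * e + v * v ≡ (v + e) * (v + e)
    complete = solve-∀

  complement-≤ : ∀ {p x y z} (q r : ℕ) → p ≡ q + r → x + y ≡ z → p * x ≤ q * z → r * z ≤ p * y
  complement-≤ {p} {x} {y} {z} q r refl refl px≤qz = +-cancelˡ-≤ (q * (x + y)) _ _ (begin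
    q * (x + y) + r * (x + y) ≡⟨ sym (*-distribʳ-+ (x + y) q r) ⟩
    (q + r) * (x + y)         ≡⟨ *-distribˡ-+ (q + r) x y ⟩
    (q + r) * x + (q + r) * y ≤⟨ +-monoˡ-≤ ((q + r) * y) px≤qz ⟩
    q * (x + y) + (q + r) * y ∎)
    where open ≤-Reasoning

  -- The case of failure probability u = v / d ≤ q / p now and at most 2u at the next iteration.
  invariant-base₁ : ∀ {d v e N F' S' S} .{{_ : NonZero d}} (p q r₁ r₂ : ℕ) → p ≡ q + r₁ → p ≡ 2 * q + r₂ →
    3 * (p * p * p) ≤ 5 * (r₁ * r₁ * r₂) → .{{_ : NonZero (p * p * p)}} → .{{_ : NonZero p}} →
    d ≡ v + e → p * v ≤ q * d → F' * d ≤ (v + v) * (F' + S') →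
    N * S' * e ≤ S * d → 3 * d * (N * (F' + S')) ≤ 5 * S * e
  invariant-base₁ {d} {v} {e} {N} {F'} {S'} {S} p q r₁ r₂ p≡₁ p≡₂ num d≡ pv≤qd F'd≤ NS'≤ =
    *-cancelˡ-≤ (p * p * p) (begin
    p * p * p * (3 * d * (N * L'))            ≡⟨ regroup₁ p d (N * L') ⟩
    -- `num` says (1 - u)² (1 - 2u) ≥ 3/5 at u = q / p: a factor 1 - u for this iteration, 1 - 2u
    -- for the next one, and another 1 - u from the denominator of the invariant.
    3 * (p * p * p) * (d * (N * L'))          ≤⟨ *-monoˡ-≤ (d * (N * L')) num ⟩
    5 * (r₁ * r₁ * r₂) * (d * (N * L'))       ≡⟨ regroup₂ r₁ r₂ d N L' ⟩
    5 * r₁ * N * (r₁ * d) * (r₂ * L')         ≤⟨ *-mono-≤ (*-monoʳ-≤ (5 * r₁ * N) r₁d≤pe) r₂L'≤pS' ⟩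
    5 * r₁ * N * (p * e) * (p * S')           ≡⟨ regroup₃ r₁ N p e S' ⟩
    5 * r₁ * (p * p) * (N * S' * e)           ≤⟨ *-monoʳ-≤ (5 * r₁ * (p * p)) NS'≤ ⟩
    5 * r₁ * (p * p) * (S * d)                ≡⟨ regroup₄ r₁ p S d ⟩
    5 * (p * p) * S * (r₁ * d)                ≤⟨ *-monoʳ-≤ (5 * (p * p) * S) r₁d≤pe ⟩
    5 * (p * p) * S * (p * e)                 ≡⟨ regroup₅ p S e ⟩
    p * p * p * (5 * S * e)                   ∎)
    where
    open ≤-Reasoning
    L' = F' + S'
    r₁d≤pe : r₁ * d ≤ p * e
    r₁d≤pe = complement-≤ q r₁ p≡₁ (sym d≡) pv≤qd
    r₂L'≤pS' : r₂ * L' ≤ p * S'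
    r₂L'≤pS' = complement-≤ (2 * q) r₂ p≡₂ refl (*-cancelʳ-≤ _ _ d (begin
      p * F' * d               ≡⟨ *-assoc p F' d ⟩
      p * (F' * d)             ≤⟨ *-monoʳ-≤ p F'd≤ ⟩
      p * ((v + v) * L')       ≡⟨ double p v L' ⟩
      2 * (p * v) * L'         ≤⟨ *-monoˡ-≤ L' (*-monoʳ-≤ 2 pv≤qd) ⟩
      2 * (q * d) * L'         ≡⟨ assoc q d L' ⟩
      2 * q * L' * d           ∎))
      where
      double : ∀ p v L → p * ((v + v) * L) ≡ 2 * (p * v) * L
      double = solve-∀
      assoc : ∀ q d L → 2 * (q * d) * L ≡ 2 * q * L * d
      assoc = solve-∀
    regroup₁ : ∀ p d L → p * p * p * (3 * d * L) ≡ 3 * (p * p * p) * (d * L)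
    regroup₁ = solve-∀
    regroup₂ : ∀ a b d N L → 5 * (a * a * b) * (d * (N * L)) ≡ 5 * a * N * (a * d) * (b * L)
    regroup₂ = solve-∀
    regroup₃ : ∀ a N p e S → 5 * a * N * (p * e) * (p * S) ≡ 5 * a * (p * p) * (N * S * e)
    regroup₃ = solve-∀
    regroup₄ : ∀ a p S d → 5 * a * (p * p) * (S * d) ≡ 5 * (p * p) * S * (a * d)
    regroup₄ = solve-∀
    regroup₅ : ∀ p S e → 5 * (p * p) * S * (p * e) ≡ p * p * p * (5 * S * e)
    regroup₅ = solve-∀

  -- The case of total failure probability at most (gn / gd) u, with u = v / d ≤ q / p.
  invariant-base₂ : ∀ {d v e L F S} .{{_ : NonZero d}} (gn gd p q r s : ℕ) → p ≡ q + r → gd * p ≡ gn * q + s →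
    3 * (gd * p * p) ≤ 5 * (s * r) → .{{_ : NonZero (gd * p * p)}} →
    d ≡ v + e → p * v ≤ q * d → F + S ≡ L → F * (gd * d) ≤ gn * v * L → 3 * d * L ≤ 5 * S * e
  invariant-base₂ {d} {v} {e} {L} {F} {S} gn gd p q r s p≡ gdp≡ num d≡ pv≤qd F+S≡L F≤ =
    *-cancelˡ-≤ (gd * p * p) (begin
    gd * p * p * (3 * d * L)      ≡⟨ regroup₁ (gd * p * p) d L ⟩
    -- `num` says (1 - g u) (1 - u) ≥ 3/5 at u = q / p with g = gn / gd.
    3 * (gd * p * p) * (d * L)    ≤⟨ *-monoˡ-≤ (d * L) num ⟩
    5 * (s * r) * (d * L)         ≡⟨ regroup₂ s r d L ⟩
    5 * (s * L) * (r * d)         ≤⟨ *-mono-≤ (*-monoʳ-≤ 5 sL≤) (complement-≤ q r p≡ (sym d≡) pv≤qd) ⟩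
    5 * (gd * p * S) * (p * e)    ≡⟨ regroup₃ gd p S e ⟩
    gd * p * p * (5 * S * e)      ∎)
    where
    open ≤-Reasoning
    sL≤ : s * L ≤ gd * p * S
    sL≤ = complement-≤ (gn * q) s gdp≡ F+S≡L (*-cancelʳ-≤ _ _ d (begin
      gd * p * F * d     ≡⟨ regroup₄ gd p F d ⟩
      p * (F * (gd * d)) ≤⟨ *-monoʳ-≤ p F≤ ⟩
      p * (gn * v * L)   ≡⟨ regroup₅ p gn v L ⟩
      gn * L * (p * v)   ≤⟨ *-monoʳ-≤ (gn * L) pv≤qd ⟩
      gn * L * (q * d)   ≡⟨ regroup₆ gn L q d ⟩
      gn * q * L * d     ∎))
      where
      regroup₄ : ∀ gd p F d → gd * p * F * d ≡ p * (F * (gd * d))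
      regroup₄ = solve-∀
      regroup₅ : ∀ p gn v L → p * (gn * v * L) ≡ gn * L * (p * v)
      regroup₅ = solve-∀
      regroup₆ : ∀ gn L q d → gn * L * (q * d) ≡ gn * q * L * d
      regroup₆ = solve-∀
    regroup₁ : ∀ c d L → c * (3 * d * L) ≡ 3 * c * (d * L)
    regroup₁ = solve-∀
    regroup₂ : ∀ s r d L → 5 * (s * r) * (d * L) ≡ 5 * (s * L) * (r * d)
    regroup₂ = solve-∀
    regroup₃ : ∀ gd p S e → 5 * (gd * p * S) * (p * e) ≡ gd * p * p * (5 * S * e)
    regroup₃ = solve-∀

  -- Here Y is P M. If R ≤ (q / p) Y, then an overflow deviates by δ ≥ (c / p) Y, so Y R ≤ (q p /
  -- c²) δ², and `num` bounds q p / c² by 20 gn / gd. The 20 is half of the lower bound 40 for P;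
  -- the half comes from the doubling of u at the next iteration.
  overflow-deviation : ∀ {R Y δ} (gn gd p q c : ℕ) → p ≡ q + c → gd * (q * p) ≤ 20 * gn * (c * c) →
    .{{_ : NonZero p}} .{{_ : NonZero (c * c)}} →
    p * R ≤ q * Y → Y ≤ R + δ → gd * (Y * R) ≤ 20 * gn * (δ * δ)
  overflow-deviation {R} {Y} {δ} gn gd p q c p≡ num pR≤qY Y≤R+δ = *-cancelˡ-≤ (c * c) (*-cancelˡ-≤ p (begin
    p * (c * c * (gd * (Y * R)))      ≡⟨ regroup₁ p c gd Y R ⟩
    gd * Y * (c * c) * (p * R)        ≤⟨ *-monoʳ-≤ (gd * Y * (c * c)) pR≤qY ⟩
    gd * Y * (c * c) * (q * Y)        ≡⟨ regroup₂ gd Y c q ⟩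
    gd * q * (c * Y * (c * Y))        ≤⟨ *-monoʳ-≤ (gd * q) (*-mono-≤ cY≤pδ cY≤pδ) ⟩
    gd * q * (p * δ * (p * δ))        ≡⟨ regroup₃ gd q p δ ⟩
    gd * (q * p) * (p * (δ * δ))      ≤⟨ *-monoˡ-≤ (p * (δ * δ)) num ⟩
    20 * gn * (c * c) * (p * (δ * δ)) ≡⟨ regroup₄ (20 * gn) (c * c) p (δ * δ) ⟩
    p * (c * c * (20 * gn * (δ * δ))) ∎))
    where
    open ≤-Reasoning
    cY≤pδ : c * Y ≤ p * δ
    cY≤pδ = +-cancelˡ-≤ (q * Y) _ _ (begin
      q * Y + c * Y   ≡⟨ sym (*-distribʳ-+ Y q c) ⟩
      (q + c) * Y     ≡⟨ cong (_* Y) (sym p≡) ⟩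
      p * Y           ≤⟨ *-monoʳ-≤ p Y≤R+δ ⟩
      p * (R + δ)     ≡⟨ *-distribˡ-+ p R δ ⟩
      p * R + p * δ   ≤⟨ +-monoˡ-≤ (p * δ) pR≤qY ⟩
      q * Y + p * δ   ∎)
    regroup₁ : ∀ p c g Y R → p * (c * c * (g * (Y * R))) ≡ g * Y * (c * c) * (p * R)
    regroup₁ = solve-∀
    regroup₂ : ∀ g Y c q → g * Y * (c * c) * (q * Y) ≡ g * q * (c * Y * (c * Y))
    regroup₂ = solve-∀
    regroup₃ : ∀ g q p δ → g * q * (p * δ * (p * δ)) ≡ g * (q * p) * (p * (δ * δ))
    regroup₃ = solve-∀
    regroup₄ : ∀ a b p e → a * b * (p * e) ≡ p * (b * (a * e))
    regroup₄ = solve-∀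

  scale-≤ : ∀ c p q x y → p * x ≤ q * y → c * p * x ≤ c * q * y
  scale-≤ c p q x y px≤qy = begin
    c * p * x   ≡⟨ *-assoc c p x ⟩
    c * (p * x) ≤⟨ *-monoʳ-≤ c px≤qy ⟩
    c * (q * y) ≡⟨ sym (*-assoc c q y) ⟩
    c * q * y   ∎
    where open ≤-Reasoning

  private
    rescale : ∀ c p q a a' b b' x y → c * p ≡ a * a' → c * q ≡ b * b' → p * x ≤ q * y → a * (a' * x) ≤ b * (b' * y)
    rescale c p q a a' b b' x y cp≡ cq≡ px≤qy = begin
      a * (a' * x) ≡⟨ sym (*-assoc a a' x) ⟩
      a * a' * x   ≡⟨ cong (_* x) (sym cp≡) ⟩
      c * p * x    ≤⟨ scale-≤ c p q x y px≤qy ⟩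
      c * q * y    ≡⟨ cong (_* y) cq≡ ⟩
      b * b' * y   ≡⟨ *-assoc b b' y ⟩
      b * (b' * y) ∎
      where open ≤-Reasoning

  -- Bounds on Y / R become bounds on u = 9 Y / (89 R): 3 / 2 turns into 27 / 178, and below 20 / 17
  -- turns into 180 / 1513. The multiplier 801 is 9 · 89.
  ratio-2/3 : ∀ {R Y} → 2 * Y ≤ 3 * R → 178 * (9 * Y) ≤ 27 * (89 * R)
  ratio-2/3 {R} {Y} = rescale 801 2 3 178 9 27 89 Y R refl refl

  ratio-17/20 : ∀ {R Y} → 17 * Y ≤ 20 * R → 1513 * (9 * Y) ≤ 180 * (89 * R)
  ratio-17/20 {R} {Y} = rescale 801 17 20 1513 9 180 89 Y R refl refl

  ratio-621/712 : ∀ {R Y} → 8 * (89 * R) ≤ 69 * (9 * Y) → 712 * R ≤ 621 * Y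
  ratio-621/712 {R} {Y} h = begin
    712 * R      ≡⟨ *-assoc 8 89 R ⟩
    8 * (89 * R) ≤⟨ h ⟩
    69 * (9 * Y) ≡⟨ sym (*-assoc 69 9 Y) ⟩
    621 * Y      ∎
    where open ≤-Reasoning

  2Y≤3R⇒9Y≤89R : ∀ {R Y} → 2 * Y ≤ 3 * R → 9 * Y ≤ 89 * R
  2Y≤3R⇒9Y≤89R {R} {Y} h = begin
    9 * Y        ≤⟨ *-monoˡ-≤ Y (m≤m+n 9 49) ⟩
    58 * Y       ≡⟨ *-assoc 29 2 Y ⟩
    29 * (2 * Y) ≤⟨ *-monoʳ-≤ 29 h ⟩
    29 * (3 * R) ≡⟨ sym (*-assoc 29 3 R) ⟩
    87 * R       ≤⟨ *-monoˡ-≤ R (m≤m+n 87 2) ⟩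
    89 * R       ∎
    where open ≤-Reasoning

  -- One call of the core

  ≤ᵇ-true : ∀ {m n} → m ≤ n → (m ≤ᵇ n) ≡ true
  ≤ᵇ-true {m} {n} m≤n with m ≤ᵇ n | ≤⇒≤ᵇ m≤n
  ... | true | _ = refl

  ≤ᵇ-false : ∀ {m n} → n < m → (m ≤ᵇ n) ≡ false
  ≤ᵇ-false {m} {n} n<m with m ≤ᵇ n in eq
  ... | false = refl
  ... | true  = ⊥-elim (<⇒≱ n<m (≤ᵇ⇒≤ m n (subst Bool.T (sym eq) tt)))

  private
    -- The continuation x is left arbitrary because the loop continues through the local function
    -- `next` of `coreLoop`, which has no name outside it.
    window-overflow : ∀ {A : Set} {P S} (f : ℕ → A) (x : A) → P < S →
      (if (1 ≤ᵇ (suc P ⊓ S)) ∧ ((suc P ⊓ S) ≤ᵇ P) then f (suc P ⊓ S) else x) ≡ x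
    window-overflow {P = P} f x P<S rewrite m≤n⇒m⊓n≡m P<S | ≤ᵇ-false (n<1+n P) = refl

    window-inside : ∀ {A : Set} {P S} (f : ℕ → A) (x : A) → 1 ≤ S → S ≤ P →
      (if (1 ≤ᵇ (suc P ⊓ S)) ∧ ((suc P ⊓ S) ≤ᵇ P) then f (suc P ⊓ S) else x) ≡ f S
    window-inside {P = P} f x 1≤S S≤P rewrite m≥n⇒m⊓n≡n (m≤n⇒m≤1+n S≤P) | ≤ᵇ-true 1≤S | ≤ᵇ-true S≤P = refl

  accepts : (ℕ → Bool) → Maybe ℕ → Bool
  accepts good = maybe′ good false

  -- The tolerance ε is abstracted away: `bad⇒far` says that a bad estimate is off by at least R
  -- √(89 / (9 P)), and `good` is otherwise arbitrary.
  module CoreAnalysis {n : ℕ} (F : CNF n) (P : ℕ) (good : ℕ → Bool)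
    (P≥40 : 40 ≤ P) (R>0 : 0 < ∣R F ∣)
    (bad⇒far : ∀ c → good c ≡ false → 89 * (∣R F ∣ * ∣R F ∣) ≤ 9 * P * (∣ c - ∣R F ∣ ∣ * ∣ c - ∣R F ∣ ∣)) where

    private
      φ : Vec Bool n → Bool
      φ = evalCNF F
      R : ℕ
      R = ∣R F ∣
      d : ℕ
      d = 89 * R
      N : ℕ → ℕ
      N m = length (allHashSteps n m)
      rests : ℕ → ℕ → ℕ
      rests m k = length (allCoreTapes n m k)
      v : ℕ → ℕ
      v m = 9 * (P * 2 ^ m)
      instance
        R≢0 : NonZero R
        R≢0 = >-nonZero R>0
        d≢0 : NonZero d
        d≢0 = >-nonZero (*-mono-≤ {1} {89} (s≤s z≤n) R>0)

    successes failures : (m k : ℕ) → ℕ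
    successes m k = ∑ (allCoreTapes n m (suc k)) (λ τ → 𝟙 (accepts good (coreLoop F P m k τ)))
    failures  m k = ∑ (allCoreTapes n m (suc k)) (λ τ → 𝟙 (not (accepts good (coreLoop F P m k τ))))

    failures+successes : ∀ m k → failures m k + successes m k ≡ length (allCoreTapes n m (suc k))
    failures+successes m k = trans (sym (∑-distrib-+ tapes _ _))
      (trans (∑-cong tapes (λ τ → 𝟙-not (accepts good (coreLoop F P m k τ)))) (sym (length≡∑ tapes)))
      where tapes = allCoreTapes n m (suc k)

    private
      failuresAfter : ∀ m k → HashStep n m → ℕ
      failuresAfter m k s = ∑ (allCoreTapes n (suc m) k) (λ ρ → 𝟙 (not (accepts good (coreLoop F P m k (s , ρ)))))

      failuresAfter-≤ : ∀ m k s → failuresAfter m k s ≤ rests (suc m) k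
      failuresAfter-≤ m k s = ≤-trans (∑-mono (allCoreTapes n (suc m) k) (λ ρ → 𝟙≤1 (not (accepts good (coreLoop F P m k (s , ρ)))))) (≤-reflexive (sym (length≡∑ (allCoreTapes n (suc m) k))))
        where
        𝟙≤1 : ∀ b → 𝟙 b ≤ 1
        𝟙≤1 true  = s≤s z≤n
        𝟙≤1 false = z≤n

      failuresAfter-overflow : ∀ m k s → P < cellSize φ s → failuresAfter m (suc k) s ≡ failures (suc m) k
      failuresAfter-overflow m k (h , α) P<S = ∑-cong (allCoreTapes n (suc m) (suc k)) (λ ρ → cong (𝟙 ∘ not ∘ accepts good) (window-overflow (λ S → just (S * 2 ^ m)) _ P<S))

      Far : ∀ {m} → HashStep n m → Set
      Far s = 89 * (R * R) ≤ 9 * P * (deviation φ s * deviation φ s)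

      -- With w = 9/89 this gives w P (R/2)² ≥ R², so a deviation by half of the mean already counts
      -- as `Far`. The margin at P = 40 is 360 against 356.
      4≤wP : 4 * 89 ≤ 9 * P
      4≤wP = ≤-trans (≤ᵇ⇒≤ (4 * 89) (9 * 40) tt) (*-monoʳ-≤ 9 P≥40)

      failuresAfter-inside : ∀ m k s → 1 ≤ cellSize φ s → cellSize φ s ≤ P → good (cellSize φ s * 2 ^ m) ≡ true →
        failuresAfter m k s ≡ 0
      failuresAfter-inside m k (h , α) 1≤S S≤P isGood =
        trans (∑-cong (allCoreTapes n (suc m) k) (λ ρ → trans
          (cong (𝟙 ∘ not ∘ accepts good) (window-inside (λ S → just (S * 2 ^ m)) _ 1≤S S≤P)) (cong (𝟙 ∘ not) isGood)))
        (trans (∑-const (allCoreTapes n (suc m) k) 0) (*-zeroʳ (rests (suc m) k)))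

      -- An empty cell does not end the loop but is charged as if everything after it failed. The
      -- variance bound already covers this, since its deviation is R.
      empty⇒far : ∀ {m} (s : HashStep n m) → cellSize φ s ≡ 0 → Far s
      empty⇒far {m} s empty = subst (λ S → 89 * (R * R) ≤ 9 * P * (∣ S * 2 ^ m - R ∣ * ∣ S * 2 ^ m - R ∣)) (sym empty)
        (*-monoˡ-≤ (R * R) (≤-trans (≤ᵇ⇒≤ 89 (4 * 89) tt) 4≤wP))

      outcome : ∀ m k s → failuresAfter m k s ≡ 0 ⊎ (Far s ⊎ P < cellSize φ s)
      outcome m k s with 1 ≤? cellSize φ s
      ... | no  empty = inj₂ (inj₁ (empty⇒far s (n<1⇒n≡0 (≰⇒> empty))))
      ... | yes 1≤S with cellSize φ s ≤? P
      ...   | no  S≰P = inj₂ (inj₂ (≰⇒> S≰P))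
      ...   | yes S≤P with good (cellSize φ s * 2 ^ m) in isGood
      ...     | false = inj₂ (inj₁ (bad⇒far _ isGood))
      ...     | true  = inj₁ (failuresAfter-inside m k s 1≤S S≤P isGood)

      overflow⇒PM≤ : ∀ {m} (s : HashStep n m) → P < cellSize φ s → P * 2 ^ m ≤ R + deviation φ s
      overflow⇒PM≤ {m} s P<S = ≤-trans (*-monoˡ-≤ (2 ^ m) (<⇒≤ P<S)) (m≤n+∣m-n∣ _ R)

      -- Chebyshev's argument in a form that admits a constant term: a pointwise bound affine in the
      -- squared deviation becomes a bound on the count by one use of the variance.
      failures-bound : ∀ m k a b c → (∀ s → failuresAfter m k s * a ≤ b + c * (deviation φ s * deviation φ s)) →
        failures m k * a ≤ N m * b + c * (N m * (2 ^ m * R))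
      failures-bound m k a b c pointwise = begin
        failures m k * a ≡⟨ cong (_* a) (∑-cartesianProduct steps (allCoreTapes n (suc m) k) _) ⟩
        ∑ steps (failuresAfter m k) * a ≡⟨ sym (∑-*ʳ steps _ a) ⟩
        ∑ steps (λ s → failuresAfter m k s * a) ≤⟨ ∑-mono steps pointwise ⟩
        ∑ steps (λ s → b + c * (deviation φ s * deviation φ s)) ≡⟨ ∑-distrib-+ steps _ _ ⟩
        ∑ steps (λ _ → b) + ∑ steps (λ s → c * (deviation φ s * deviation φ s))
          ≡⟨ cong₂ _+_ (∑-const steps b) (∑-*ˡ steps c _) ⟩
        N m * b + c * ∑ steps (λ s → deviation φ s * deviation φ s)
          ≤⟨ +-monoʳ-≤ (N m * b) (*-monoʳ-≤ c (cellSize-variance φ m)) ⟩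
        N m * b + c * (N m * (2 ^ m * R)) ∎
        where
        open ≤-Reasoning
        steps = allHashSteps n m

      tapes-suc : ∀ m k → length (allCoreTapes n m (suc k)) ≡ N m * rests (suc m) k
      tapes-suc m k = length-cartesianProduct (allHashSteps n m) (allCoreTapes n (suc m) k)

      far-bound : ∀ {m} L (s : HashStep n m) → Far s → L * (89 * (R * R)) ≤ 9 * P * L * (deviation φ s * deviation φ s)
      far-bound L s far = ≤-trans (*-monoʳ-≤ L far) (≤-reflexive (swap L (9 * P) _))
        where
        swap : ∀ a b c → a * (b * c) ≡ b * a * c
        swap = solve-∀

    -- Once R ≤ (2/3) P 2^m, a cell that overflows deviates from its mean by at least half of it.
    failures-terminal : ∀ m k → 3 * R ≤ 2 * (P * 2 ^ m) → failures m k * d ≤ v m * length (allCoreTapes n m (suc k))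
    failures-terminal m k 3R≤2PM = *-cancelʳ-≤ _ _ R (begin
      failures m k * d * R            ≡⟨ regroup₁ (failures m k) R ⟩
      failures m k * (89 * (R * R))   ≤⟨ failures-bound m k (89 * (R * R)) 0 (9 * P * L') pointwise ⟩
      N m * 0 + 9 * P * L' * (N m * (2 ^ m * R)) ≡⟨ regroup₂ (N m) P L' (2 ^ m) R ⟩
      v m * (N m * L') * R            ≡⟨ cong (λ L → v m * L * R) (sym (tapes-suc m k)) ⟩
      v m * length (allCoreTapes n m (suc k)) * R ∎)
      where
      open ≤-Reasoning
      L' = rests (suc m) k
      regroup₁ : ∀ f r → f * (89 * r) * r ≡ f * (89 * (r * r))
      regroup₁ = solve-∀
      regroup₂ : ∀ N P L M R → N * 0 + 9 * P * L * (N * (M * R)) ≡ 9 * (P * M) * (N * L) * R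
      regroup₂ = solve-∀
      overflow⇒far : ∀ s → P < cellSize φ s → Far s
      overflow⇒far s P<S = begin
        89 * (R * R)              ≤⟨ *-monoʳ-≤ 89 (*-mono-≤ R≤2δ R≤2δ) ⟩
        89 * (2 * δ * (2 * δ))    ≡⟨ regroup₃ δ ⟩
        4 * 89 * (δ * δ)          ≤⟨ *-monoˡ-≤ (δ * δ) 4≤wP ⟩
        9 * P * (δ * δ)           ∎
        where
        δ = deviation φ s
        regroup₃ : ∀ e → 89 * (2 * e * (2 * e)) ≡ 4 * 89 * (e * e)
        regroup₃ = solve-∀
        R≤2δ : R ≤ 2 * δ
        R≤2δ = +-cancelˡ-≤ (2 * R) _ _ (begin
          2 * R + R       ≡⟨ +-comm (2 * R) R ⟩
          3 * R           ≤⟨ 3R≤2PM ⟩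
          2 * (P * 2 ^ m) ≤⟨ *-monoʳ-≤ 2 (overflow⇒PM≤ s P<S) ⟩
          2 * (R + δ)     ≡⟨ *-distribˡ-+ 2 R δ ⟩
          2 * R + 2 * δ   ∎)
      pointwise : ∀ s → failuresAfter m k s * (89 * (R * R)) ≤ 9 * P * L' * (deviation φ s * deviation φ s)
      pointwise s with outcome m k s
      ... | inj₁ none rewrite none = z≤n
      ... | inj₂ (inj₁ far) = ≤-trans (*-monoˡ-≤ _ (failuresAfter-≤ m k s)) (far-bound L' s far)
      ... | inj₂ (inj₂ P<S) = ≤-trans (*-monoˡ-≤ _ (failuresAfter-≤ m k s)) (far-bound L' s (overflow⇒far s P<S))

    -- An overflow leaves exactly the F' failures of the next iteration. A far cell turns at worst
    -- all F' + S' continuations into failures, so it is charged only S' beyond F'. With F' as the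
    -- constant term, the result is the same as if being far and failing later were independent.
    failures-suc : ∀ m k → failures m (suc k) * d ≤ N m * (failures (suc m) k * d + v m * successes (suc m) k)
    failures-suc m k = *-cancelʳ-≤ _ _ R (begin
      failures m (suc k) * d * R            ≡⟨ regroup₁ (failures m (suc k)) R ⟩
      failures m (suc k) * (89 * (R * R))
        ≤⟨ failures-bound m (suc k) (89 * (R * R)) (F' * (89 * (R * R))) (9 * P * S') pointwise ⟩
      N m * (F' * (89 * (R * R))) + 9 * P * S' * (N m * (2 ^ m * R)) ≡⟨ regroup₂ (N m) F' P S' (2 ^ m) R ⟩
      N m * (F' * d + v m * S') * R ∎)
      where
      open ≤-Reasoning
      F' = failures (suc m) k
      S' = successes (suc m) k
      regroup₁ : ∀ f r → f * (89 * r) * r ≡ f * (89 * (r * r))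
      regroup₁ = solve-∀
      regroup₂ : ∀ N F P S M R → N * (F * (89 * (R * R))) + 9 * P * S * (N * (M * R)) ≡ N * (F * (89 * R) + 9 * (P * M) * S) * R
      regroup₂ = solve-∀
      pointwise : ∀ s → failuresAfter m (suc k) s * (89 * (R * R)) ≤ F' * (89 * (R * R)) + 9 * P * S' * (deviation φ s * deviation φ s)
      pointwise s with outcome m (suc k) s
      ... | inj₁ none rewrite none = z≤n
      ... | inj₂ (inj₁ far) = begin
        failuresAfter m (suc k) s * (89 * (R * R)) ≤⟨ *-monoˡ-≤ _ (failuresAfter-≤ m (suc k) s) ⟩
        rests (suc m) (suc k) * (89 * (R * R))     ≡⟨ cong (_* (89 * (R * R))) (sym (failures+successes (suc m) k)) ⟩
        (F' + S') * (89 * (R * R))                 ≡⟨ *-distribʳ-+ (89 * (R * R)) F' S' ⟩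
        F' * (89 * (R * R)) + S' * (89 * (R * R))  ≤⟨ +-monoʳ-≤ (F' * (89 * (R * R))) (far-bound S' s far) ⟩
        F' * (89 * (R * R)) + 9 * P * S' * (deviation φ s * deviation φ s) ∎
      ... | inj₂ (inj₂ P<S) = ≤-trans (≤-reflexive (cong (_* (89 * (R * R))) (failuresAfter-overflow m k s P<S))) (m≤m+n _ _)

    -- Overflow is charged only the failure probability of the next iteration, so the
    -- failures of both kinds are dominated by the single quadratic (gn / gd) δ² / (β R)².
    failures-near : ∀ m k gn gd → gd ≤ gn → 3 * R ≤ 2 * (P * 2 ^ suc m) →
      (∀ δ → P * 2 ^ m ≤ R + δ → gd * (P * 2 ^ m * R) ≤ 20 * gn * (δ * δ)) →
      failures m (suc k) * (gd * d) ≤ gn * v m * length (allCoreTapes n m (suc (suc k)))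
    failures-near m k gn gd gd≤gn next-terminal separated = *-cancelʳ-≤ _ _ R (begin
      failures m (suc k) * (gd * d) * R              ≡⟨ regroup₁ (failures m (suc k)) gd R ⟩
      failures m (suc k) * (gd * (89 * (R * R)))
        ≤⟨ failures-bound m (suc k) (gd * (89 * (R * R))) 0 (gn * (9 * P * L')) pointwise ⟩
      N m * 0 + gn * (9 * P * L') * (N m * (2 ^ m * R)) ≡⟨ regroup₂ (N m) gn P L' (2 ^ m) R ⟩
      gn * v m * (N m * L') * R                      ≡⟨ cong (λ L → gn * v m * L * R) (sym (tapes-suc m (suc k))) ⟩
      gn * v m * length (allCoreTapes n m (suc (suc k))) * R ∎)
      where
      open ≤-Reasoning
      L' = rests (suc m) (suc k)
      F' = failures (suc m) k
      M = 2 ^ m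
      regroup₁ : ∀ f g r → f * (g * (89 * r)) * r ≡ f * (g * (89 * (r * r)))
      regroup₁ = solve-∀
      regroup₂ : ∀ N g P L M R → N * 0 + g * (9 * P * L) * (N * (M * R)) ≡ g * (9 * (P * M)) * (N * L) * R
      regroup₂ = solve-∀
      overflow : ∀ s → P < cellSize φ s → F' * (gd * (89 * (R * R))) ≤ gn * (9 * P * L') * (deviation φ s * deviation φ s)
      -- The factor 20 turns the 2 M cells of the next iteration into 40 M ≤ P M.
      overflow s P<S = *-cancelˡ-≤ 20 (begin
        20 * (F' * (gd * (89 * (R * R))))             ≡⟨ regroup₃ F' gd R ⟩
        20 * (gd * R) * (F' * (89 * R))               ≤⟨ *-monoʳ-≤ (20 * (gd * R)) (failures-terminal (suc m) k next-terminal) ⟩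
        20 * (gd * R) * (9 * (P * (2 * M)) * L')      ≡⟨ regroup₄ gd R P M L' ⟩
        gd * (40 * M * R) * (9 * P * L')              ≤⟨ *-monoˡ-≤ (9 * P * L') (*-monoʳ-≤ gd (*-monoˡ-≤ R (*-monoˡ-≤ M P≥40))) ⟩
        gd * (P * M * R) * (9 * P * L')               ≤⟨ *-monoˡ-≤ (9 * P * L') (separated δ (overflow⇒PM≤ s P<S)) ⟩
        20 * gn * (δ * δ) * (9 * P * L')              ≡⟨ regroup₅ gn (δ * δ) (9 * P * L') ⟩
        20 * (gn * (9 * P * L') * (δ * δ))            ∎)
        where
        δ = deviation φ s
        regroup₃ : ∀ F g R → 20 * (F * (g * (89 * (R * R)))) ≡ 20 * (g * R) * (F * (89 * R))
        regroup₃ = solve-∀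
        regroup₄ : ∀ g R P M L → 20 * (g * R) * (9 * (P * (2 * M)) * L) ≡ g * (40 * M * R) * (9 * P * L)
        regroup₄ = solve-∀
        regroup₅ : ∀ g e w → 20 * g * e * w ≡ 20 * (g * w * e)
        regroup₅ = solve-∀
      pointwise : ∀ s → failuresAfter m (suc k) s * (gd * (89 * (R * R))) ≤ gn * (9 * P * L') * (deviation φ s * deviation φ s)
      pointwise s with outcome m (suc k) s
      ... | inj₁ none rewrite none = z≤n
      ... | inj₂ (inj₁ far) = begin
        failuresAfter m (suc k) s * (gd * (89 * (R * R))) ≤⟨ *-mono-≤ (failuresAfter-≤ m (suc k) s) (*-monoˡ-≤ (89 * (R * R)) gd≤gn) ⟩
        L' * (gn * (89 * (R * R)))                        ≡⟨ swap L' gn (89 * (R * R)) ⟩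
        gn * (L' * (89 * (R * R)))                        ≤⟨ *-monoʳ-≤ gn (far-bound L' s far) ⟩
        gn * (9 * P * L' * (deviation φ s * deviation φ s)) ≡⟨ sym (*-assoc gn _ _) ⟩
        gn * (9 * P * L') * (deviation φ s * deviation φ s) ∎
        where
        swap : ∀ a b c → a * (b * c) ≡ b * (a * c)
        swap = solve-∀
      ... | inj₂ (inj₂ P<S) =
        ≤-trans (≤-reflexive (cong (_* (gd * (89 * (R * R)))) (failuresAfter-overflow m k s P<S))) (overflow s P<S)

    private
      v-suc : ∀ m → v (suc m) ≡ v m + v m
      v-suc m = double P (2 ^ m)
        where
        double : ∀ p m → 9 * (p * (2 * m)) ≡ 9 * (p * m) + 9 * (p * m)
        double = solve-∀

    -- The hypothesis 2 R ≤ P M 2^k makes R ≤ P M / 2 at the last iteration, contrary to 2 P M < 3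
    -- R. Hence wherever the bound is established, there is a next iteration to charge overflow to.
    core-invariant : ∀ k m → 2 * R ≤ P * 2 ^ m * 2 ^ k → 2 * (P * 2 ^ m) < 3 * R →
      ∀ e → d ≡ v m + e → 3 * d * length (allCoreTapes n m (suc k)) ≤ 5 * successes m k * e
    core-invariant zero m enough 2PM<3R = ⊥-elim (<⇒≱ 2PM<3R (begin
      3 * R             ≤⟨ m≤n+m (3 * R) R ⟩
      R + 3 * R         ≡⟨ four R ⟩
      2 * (2 * R)       ≤⟨ *-monoʳ-≤ 2 enough ⟩
      2 * (P * 2 ^ m * 1) ≡⟨ cong (2 *_) (*-identityʳ (P * 2 ^ m)) ⟩
      2 * (P * 2 ^ m)   ∎))
      where
      open ≤-Reasoning
      four : ∀ r → r + 3 * r ≡ 2 * (2 * r)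
      four = solve-∀
    core-invariant (suc k) m enough 2PM<3R e d≡ with 2 * (P * 2 ^ suc m) <? 3 * R
    ... | yes next<3R =
      subst (λ e → 3 * d * length (allCoreTapes n m (suc (suc k))) ≤ 5 * successes m (suc k) * e) (sym e≡)
        (subst (λ L → 3 * d * L ≤ 5 * successes m (suc k) * (v m + e')) (sym (tapes-suc m (suc k)))
          (invariant-step {d} {v m} {e'} {N m} {rests (suc m) (suc k)} {successes (suc m) k} {successes m (suc k)} d≡′
            (remaining-success {d} {v m} {v m + e'} {N m} {failures (suc m) k} {successes (suc m) k} {failures m (suc k)} {successes m (suc k)} d≡′ total (failures-suc m k))
            (core-invariant k (suc m) (≤-trans enough (≤-reflexive (shift P (2 ^ m) (2 ^ k)))) next<3R e' d≡v'+e')))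
      where
      open ≤-Reasoning
      shift : ∀ p m k → p * m * (2 * k) ≡ p * (2 * m) * k
      shift = solve-∀
      v'≤d : v (suc m) ≤ d
      v'≤d = 2Y≤3R⇒9Y≤89R {R} {P * 2 ^ suc m} (<⇒≤ next<3R)
      e' = d ∸ v (suc m)
      d≡v'+e' : d ≡ v (suc m) + e'
      d≡v'+e' = sym (m+[n∸m]≡n v'≤d)
      d≡′ : d ≡ v m + (v m + e')
      d≡′ = trans d≡v'+e' (trans (cong (_+ e') (v-suc m)) (+-assoc (v m) (v m) e'))
      e≡ : e ≡ v m + e'
      e≡ = +-cancelˡ-≡ (v m) e (v m + e') (trans (sym d≡) d≡′)
      total : failures m (suc k) + successes m (suc k) ≡ N m * (failures (suc m) k + successes (suc m) k)
      total = trans (failures+successes m (suc k)) (trans (tapes-suc m (suc k)) (cong (N m *_) (sym (failures+successes (suc m) k))))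
    -- 8 / 69 lies just below the root of (1 - u)² (1 - 2u) = 3/5.
    ... | no next≮3R with 69 * v m ≤? 8 * d
    ...   | yes 69v≤8d =
      subst (λ L → 3 * d * L ≤ 5 * successes m (suc k) * e) (sym total)
        (invariant-base₁ {d} {v m} {e} {N m} {failures (suc m) k} {successes (suc m) k} {successes m (suc k)} 69 8 61 53 refl refl (≤ᵇ⇒≤ (3 * (69 * 69 * 69)) (5 * (61 * 61 * 53)) tt) d≡ 69v≤8d
          next-failures (remaining-success {d} {v m} {e} {N m} {failures (suc m) k} {successes (suc m) k} {failures m (suc k)} {successes m (suc k)} d≡ (trans (failures+successes m (suc k)) total) (failures-suc m k)))
      where
      total : length (allCoreTapes n m (suc (suc k))) ≡ N m * (failures (suc m) k + successes (suc m) k)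
      total = trans (tapes-suc m (suc k)) (cong (N m *_) (sym (failures+successes (suc m) k)))
      next-failures : failures (suc m) k * d ≤ (v m + v m) * (failures (suc m) k + successes (suc m) k)
      next-failures = ≤-trans (failures-terminal (suc m) k (≮⇒≥ next≮3R))
        (≤-reflexive (cong₂ _*_ (v-suc m) (sym (failures+successes (suc m) k))))
    -- A smaller R / (P M) makes u larger but separates an overflow better from the mean. Combining
    -- the worst of both, u ≤ 27 / 178 and the factor 267 / 100, would miss 3/5, so the range is cut
    -- at 17 / 20.
    ...   | no 69v≰8d with 20 * R ≤? 17 * (P * 2 ^ m)
    ...     | yes 20R≤17Y =
      -- 17 / 9 is exactly q p / (20 c²) for q / p = 17 / 20 and c = 3.
      invariant-base₂ {d} {v m} {e} {length (allCoreTapes n m (suc (suc k)))} {failures m (suc k)} {successes m (suc k)} 17 9 178 27 151 1143 refl refl (≤ᵇ⇒≤ (3 * (9 * 178 * 178)) (5 * (1143 * 151)) tt) d≡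
        small (failures+successes m (suc k))
        (failures-near m k 17 9 (≤ᵇ⇒≤ 9 17 tt) (≮⇒≥ next≮3R)
          (λ δ → overflow-deviation {R} {P * 2 ^ m} {δ} 17 9 20 17 3 refl (≤ᵇ⇒≤ (9 * (17 * 20)) (20 * 17 * (3 * 3)) tt) 20R≤17Y))
      where
      small : 178 * v m ≤ 27 * d
      small = ratio-2/3 {R} {P * 2 ^ m} (<⇒≤ 2PM<3R)
    ...     | no 20R≰17Y =
      -- u > 8 / 69 means R / (P M) < 621 / 712; there q p / (20 c²) with c = 91 is about 2.6697,
      -- rounded up to 267 / 100.
      invariant-base₂ {d} {v m} {e} {length (allCoreTapes n m (suc (suc k)))} {failures m (suc k)} {successes m (suc k)} 267 100 1513 180 1333 103240 refl refl (≤ᵇ⇒≤ (3 * (100 * 1513 * 1513)) (5 * (103240 * 1333)) tt) d≡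
        small (failures+successes m (suc k))
        (failures-near m k 267 100 (≤ᵇ⇒≤ 100 267 tt) (≮⇒≥ next≮3R)
          (λ δ → overflow-deviation {R} {P * 2 ^ m} {δ} 267 100 712 621 91 refl (≤ᵇ⇒≤ (100 * (621 * 712)) (20 * 267 * (91 * 91)) tt) 712R≤621Y))
      where
      small : 1513 * v m ≤ 180 * d
      small = ratio-17/20 {R} {P * 2 ^ m} (<⇒≤ (≰⇒> 20R≰17Y))
      712R≤621Y : 712 * R ≤ 621 * (P * 2 ^ m)
      712R≤621Y = ratio-621/712 {R} {P * 2 ^ m} (<⇒≤ (≰⇒> 69v≰8d))

  2*⌊n/2⌋≤n : ∀ n → 2 * ⌊ n /2⌋ ≤ n
  2*⌊n/2⌋≤n n = begin
    2 * ⌊ n /2⌋           ≡⟨ cong (⌊ n /2⌋ +_) (+-identityʳ _) ⟩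
    ⌊ n /2⌋ + ⌊ n /2⌋     ≤⟨ +-monoʳ-≤ ⌊ n /2⌋ (⌊n/2⌋≤⌈n/2⌉ n) ⟩
    ⌊ n /2⌋ + ⌈ n /2⌉     ≡⟨ ⌊n/2⌋+⌈n/2⌉≡n n ⟩
    n                     ∎
    where open ≤-Reasoning

  private
    2^⌊log2⌋≤n : ∀ n (a : Acc _<_ n) → 1 ≤ n → 2 ^ ⌊log2⌋ n a ≤ n
    2^⌊log2⌋≤n 1             _        _ = s≤s z≤n
    2^⌊log2⌋≤n (suc (suc n)) (acc rs) _ =
      ≤-trans (*-monoʳ-≤ 2 (2^⌊log2⌋≤n (suc ⌊ n /2⌋) _ (s≤s z≤n))) (2*⌊n/2⌋≤n (suc (suc n)))

  -- This is the room needed at the last iteration: together with R ≤ 2^n it gives R ≤ P M / 2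
  -- there.
  2*2^lOf≤ : ∀ P → 2 ≤ P → 2 * 2 ^ lOf P ≤ P
  2*2^lOf≤ P 2≤P = begin
    2 * 2 ^ lOf P             ≡⟨ cong (λ l → 2 * 2 ^ l) (sym (⌊log₂⌊n/2⌋⌋≡⌊log₂n⌋∸1 P)) ⟩
    2 * 2 ^ ⌊log₂ ⌊ P /2⌋ ⌋   ≤⟨ *-monoʳ-≤ 2 (2^⌊log2⌋≤n ⌊ P /2⌋ _ (⌊n/2⌋-mono 2≤P)) ⟩
    2 * ⌊ P /2⌋               ≤⟨ 2*⌊n/2⌋≤n P ⟩
    P                         ∎
    where open ≤-Reasoning

  length-allVecsOf : ∀ {A : Set} (xs : List A) m → length (allVecsOf xs m) ≡ length xs ^ m
  length-allVecsOf xs zero    = refl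
  length-allVecsOf xs (suc m) = begin
    length (allVecsOf xs (suc m))                        ≡⟨ length≡∑ (allVecsOf xs (suc m)) ⟩
    ∑ (allVecsOf xs (suc m)) (λ _ → 1)                   ≡⟨ ∑-allVecsOf xs m _ ⟩
    ∑ xs (λ _ → ∑ (allVecsOf xs m) (λ _ → 1))            ≡⟨ ∑-const xs _ ⟩
    length xs * ∑ (allVecsOf xs m) (λ _ → 1)             ≡⟨ cong (length xs *_) (sym (length≡∑ (allVecsOf xs m))) ⟩
    length xs * length (allVecsOf xs m)                  ≡⟨ cong (length xs *_) (length-allVecsOf xs m) ⟩
    length xs * length xs ^ m                            ∎
    where open ≡-Reasoning

  countTrue≤length : ∀ {A : Set} (p : A → Bool) xs → countTrue p xs ≤ length xs
  countTrue≤length p []       = z≤n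
  countTrue≤length p (x ∷ xs) with p x
  ... | true  = s≤s (countTrue≤length p xs)
  ... | false = m≤n⇒m≤1+n (countTrue≤length p xs)

  #sat≤2^n : ∀ {n} (φ : Assignment n → Bool) → #sat φ ≤ 2 ^ n
  #sat≤2^n {n} φ = ≤-trans (countTrue≤length φ (allAssignments n)) (≤-reflexive (length-allVecsOf bits n))

  core-success : ∀ {n} (F : CNF n) (P : ℕ) (good : ℕ → Bool) → 40 ≤ P → good ∣R F ∣ ≡ true →
    (∀ c → good c ≡ false → 89 * (∣R F ∣ * ∣R F ∣) ≤ 9 * P * (∣ c - ∣R F ∣ ∣ * ∣ c - ∣R F ∣ ∣)) →
    3 * length (allCoreTapesFor n P) ≤ 5 * ∑ (allCoreTapesFor n P) (λ τ → 𝟙 (accepts good (ApproxMCCore F P τ)))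
  core-success {n} F P good P≥40 R-good bad⇒far with ∣R F ∣ ≤? P
  ... | yes R≤P = begin
    3 * length tapes                                             ≤⟨ *-monoˡ-≤ (length tapes) (m≤m+n 3 2) ⟩
    5 * length tapes                                             ≡⟨ cong (5 *_) (length≡∑ tapes) ⟩
    5 * ∑ tapes (λ _ → 1)                                        ≡⟨ cong (5 *_) (∑-cong tapes (λ τ → sym (trans (cong (𝟙 ∘ accepts good) (exact τ)) (cong 𝟙 R-good)))) ⟩
    5 * ∑ tapes (λ τ → 𝟙 (accepts good (ApproxMCCore F P τ)))    ∎
    where
    open ≤-Reasoning
    tapes = allCoreTapesFor n P
    exact : ∀ τ → ApproxMCCore F P τ ≡ just ∣R F ∣
    exact τ rewrite m≥n⇒m⊓n≡n (m≤n⇒m≤1+n R≤P) | ≤ᵇ-true R≤P = refl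
  ... | no R≰P = *-cancelˡ-≤ (89 * R) (begin
    89 * R * (3 * length tapes)            ≡⟨ regroup₁ (89 * R) (length tapes) ⟩
    3 * (89 * R) * length tapes            ≤⟨ core-invariant k 0 enough 2P<3R e (sym (m+[n∸m]≡n v≤d)) ⟩
    -- Here the strengthening by 1 / (1 - u) has done its work and is given up.
    5 * successes 0 k * e                  ≤⟨ *-monoʳ-≤ (5 * successes 0 k) (m∸n≤m (89 * R) (9 * (P * 1))) ⟩
    5 * successes 0 k * (89 * R)           ≡⟨ *-comm (5 * successes 0 k) (89 * R) ⟩
    89 * R * (5 * successes 0 k)           ≡⟨ cong (λ S → 89 * R * (5 * S)) (∑-cong tapes (λ τ → sym (cong (𝟙 ∘ accepts good) (loops τ)))) ⟩
    89 * R * (5 * ∑ tapes (λ τ → 𝟙 (accepts good (ApproxMCCore F P τ)))) ∎)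
    where
    open ≤-Reasoning
    R = ∣R F ∣
    tapes = allCoreTapesFor n P
    k = n ∸ lOf P
    P<R : P < R
    P<R = ≰⇒> R≰P
    R>0 : 0 < R
    R>0 = ≤-trans (s≤s z≤n) P<R
    instance
      89R≢0 : NonZero (89 * R)
      89R≢0 = >-nonZero (*-mono-≤ {1} {89} (s≤s z≤n) R>0)
    open CoreAnalysis F P good P≥40 R>0 bad⇒far
    loops : ∀ τ → ApproxMCCore F P τ ≡ coreLoop F P 0 k τ
    loops τ rewrite m≤n⇒m⊓n≡m P<R | ≤ᵇ-false (n<1+n P) = refl
    regroup₁ : ∀ d L → d * (3 * L) ≡ 3 * d * L
    regroup₁ = solve-∀
    2P<3R : 2 * (P * 1) < 3 * R
    2P<3R = begin-strict
      2 * (P * 1) ≡⟨ cong (2 *_) (*-identityʳ P) ⟩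
      2 * P       <⟨ *-monoʳ-< 2 P<R ⟩
      2 * R       ≤⟨ *-monoˡ-≤ R (n≤1+n 2) ⟩
      3 * R       ∎
    v≤d : 9 * (P * 1) ≤ 89 * R
    v≤d = 2Y≤3R⇒9Y≤89R {R} {P * 1} (<⇒≤ 2P<3R)
    e = 89 * R ∸ 9 * (P * 1)
    enough : 2 * R ≤ P * 1 * 2 ^ k
    enough = begin
      2 * R                     ≤⟨ *-monoʳ-≤ 2 (#sat≤2^n (evalCNF F)) ⟩
      2 * 2 ^ n                 ≤⟨ *-monoʳ-≤ 2 (^-monoʳ-≤ 2 (m≤n+m∸n n (lOf P))) ⟩
      2 * 2 ^ (lOf P + k)       ≡⟨ cong (2 *_) (^-distribˡ-+-* 2 (lOf P) k) ⟩
      2 * (2 ^ lOf P * 2 ^ k)   ≡⟨ sym (*-assoc 2 (2 ^ lOf P) (2 ^ k)) ⟩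
      2 * 2 ^ lOf P * 2 ^ k     ≤⟨ *-monoˡ-≤ (2 ^ k) (2*2^lOf≤ P (≤-trans (s≤s (s≤s z≤n)) P≥40)) ⟩
      P * 2 ^ k                 ≡⟨ cong (_* 2 ^ k) (sym (*-identityʳ P)) ⟩
      P * 1 * 2 ^ k             ∎

  -- The exponential moment method, with weights 25 and 36 whose geometric mean is 30.
  module Chernoff {A : Set} (Ω : List A) (g : A → Bool) where

    -- For success probability 3/5 the best ratio of the weights is (2/5) / (3/5) = 2/3. The ratio
    -- 25 / 36 is close to it and consists of squares. The mean weight is then at most 147 / 5 = 30
    -- · 49 / 50.
    weight : Bool → ℕ
    weight b = if b then 25 else 36

    weights : ∀ {t} → Vec A t → ℕ
    weights []      = 1
    weights (x ∷ v) = weight (g x) * weights v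

    hitCount : ∀ {t} → Vec A t → ℕ
    hitCount v = countTrue g (Vec.toList v)

    weights-∑ : ∀ t → ∑ (allVecsOf Ω t) weights ≡ ∑ Ω (weight ∘ g) ^ t
    weights-∑ zero    = refl
    weights-∑ (suc t) = begin
      ∑ (allVecsOf Ω (suc t)) weights                                ≡⟨ ∑-allVecsOf Ω t weights ⟩
      ∑ Ω (λ x → ∑ (allVecsOf Ω t) (λ v → weight (g x) * weights v)) ≡⟨ ∑-*-∑ Ω (allVecsOf Ω t) (weight ∘ g) weights ⟩
      ∑ Ω (weight ∘ g) * ∑ (allVecsOf Ω t) weights                   ≡⟨ cong (∑ Ω (weight ∘ g) *_) (weights-∑ t) ⟩
      ∑ Ω (weight ∘ g) * ∑ Ω (weight ∘ g) ^ t                        ∎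
      where open ≡-Reasoning

    weights-hitCount : ∀ {t} (v : Vec A t) → weights v * 36 ^ hitCount v ≡ 36 ^ t * 25 ^ hitCount v
    weights-hitCount []      = refl
    weights-hitCount {suc t} (x ∷ v) with g x
    ... | true  = trans (trade (weights v) (36 ^ hitCount v)) (trans (cong (25 * 36 *_) (weights-hitCount v)) (untrade (36 ^ t) (25 ^ hitCount v)))
      where
      trade : ∀ w a → 25 * w * (36 * a) ≡ 25 * 36 * (w * a)
      trade = solve-∀
      untrade : ∀ a b → 25 * 36 * (a * b) ≡ 36 * a * (25 * b)
      untrade = solve-∀
    ... | false = trans (*-assoc 36 (weights v) _) (trans (cong (36 *_) (weights-hitCount v)) (sym (*-assoc 36 (36 ^ t) _)))

    -- Each of the h successes is paired with a failure, 25 · 36 = 30², and the r unpaired calls are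
    -- failures of weight 36 ≥ 30.
    minority⇒heavy : ∀ {t} (v : Vec A t) → 2 * hitCount v ≤ t → 30 ^ t ≤ weights v
    minority⇒heavy {t} v 2h≤t = *-cancelʳ-≤ _ _ (36 ^ h) {{m^n≢0 36 h}} (begin
      30 ^ t * 36 ^ h                       ≡⟨ cong₂ _*_ (^-distribʳ-* 6 5 t) (^-distribʳ-* 6 6 h) ⟩
      6 ^ t * 5 ^ t * (6 ^ h * 6 ^ h)       ≡⟨ cong (λ a → 6 ^ t * a * (6 ^ h * 6 ^ h)) (split 5) ⟩
      6 ^ t * (5 ^ r * (5 ^ h * 5 ^ h)) * (6 ^ h * 6 ^ h)
        ≤⟨ *-monoˡ-≤ (6 ^ h * 6 ^ h) (*-monoʳ-≤ (6 ^ t) (*-monoˡ-≤ (5 ^ h * 5 ^ h) (^-monoˡ-≤ r (n≤1+n 5)))) ⟩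
      6 ^ t * (6 ^ r * (5 ^ h * 5 ^ h)) * (6 ^ h * 6 ^ h) ≡⟨ regroup (6 ^ t) (6 ^ r) (5 ^ h * 5 ^ h) (6 ^ h * 6 ^ h) ⟩
      6 ^ t * (6 ^ r * (6 ^ h * 6 ^ h)) * (5 ^ h * 5 ^ h)
        ≡⟨ cong₂ _*_ (cong (6 ^ t *_) (sym (split 6))) (sym (^-distribʳ-* 5 5 h)) ⟩
      6 ^ t * 6 ^ t * 25 ^ h                ≡⟨ cong (_* 25 ^ h) (sym (^-distribʳ-* 6 6 t)) ⟩
      36 ^ t * 25 ^ h                       ≡⟨ sym (weights-hitCount v) ⟩
      weights v * 36 ^ h                    ∎)
      where
      open ≤-Reasoning
      h = hitCount v
      r = t ∸ 2 * h
      split : ∀ a → a ^ t ≡ a ^ r * (a ^ h * a ^ h)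
      split a = trans (cong (a ^_) (sym (m∸n+n≡m 2h≤t))) (trans (^-distribˡ-+-* a r (2 * h))
        (cong (a ^ r *_) (trans (cong (a ^_) (cong (h +_) (+-identityʳ h))) (^-distribˡ-+-* a h h))))
      regroup : ∀ a b c d → a * (b * c) * d ≡ a * (b * d) * c
      regroup = solve-∀

    majority-amplification : ∀ t (bad : Vec A t → Bool) → (∀ v → bad v ≡ true → 2 * hitCount v ≤ t) →
      3 * length Ω ≤ 5 * ∑ Ω (𝟙 ∘ g) →
      ∑ (allVecsOf Ω t) (𝟙 ∘ bad) * 50 ^ t ≤ 49 ^ t * length (allVecsOf Ω t)
    majority-amplification t bad bad⇒minority 3N≤5G = *-cancelˡ-≤ (3 ^ t) {{m^n≢0 3 t}} (begin
      3 ^ t * (B * 50 ^ t)                     ≡⟨ swap (3 ^ t) B (50 ^ t) ⟩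
      -- 3 · 50 and 30 · 5 both compute to 150.
      B * (3 ^ t * 50 ^ t)                     ≡⟨ cong (B *_) (trans (sym (^-distribʳ-* 3 50 t)) (^-distribʳ-* 30 5 t)) ⟩
      B * (30 ^ t * 5 ^ t)                     ≡⟨ sym (*-assoc B (30 ^ t) (5 ^ t)) ⟩
      B * 30 ^ t * 5 ^ t                       ≤⟨ *-monoˡ-≤ (5 ^ t) markov ⟩
      W ^ t * 5 ^ t                            ≡⟨ trans (sym (^-distribʳ-* W 5 t)) (cong (_^ t) (*-comm W 5)) ⟩
      (5 * W) ^ t                              ≤⟨ ^-monoˡ-≤ t 5W≤147N ⟩
      (3 * (49 * length Ω)) ^ t                ≡⟨ trans (^-distribʳ-* 3 (49 * length Ω) t) (cong (3 ^ t *_) (^-distribʳ-* 49 (length Ω) t)) ⟩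
      3 ^ t * (49 ^ t * length Ω ^ t)          ≡⟨ cong (λ l → 3 ^ t * (49 ^ t * l)) (sym (length-allVecsOf Ω t)) ⟩
      3 ^ t * (49 ^ t * length (allVecsOf Ω t)) ∎)
      where
      open ≤-Reasoning
      B = ∑ (allVecsOf Ω t) (𝟙 ∘ bad)
      W = ∑ Ω (weight ∘ g)
      G = ∑ Ω (𝟙 ∘ g)
      swap : ∀ a b c → a * (b * c) ≡ b * (a * c)
      swap = solve-∀
      markov : B * 30 ^ t ≤ W ^ t
      markov = begin
        B * 30 ^ t                                   ≡⟨ sym (∑-*ʳ (allVecsOf Ω t) (𝟙 ∘ bad) (30 ^ t)) ⟩
        ∑ (allVecsOf Ω t) (λ v → 𝟙 (bad v) * 30 ^ t) ≤⟨ ∑-mono (allVecsOf Ω t) pointwise ⟩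
        ∑ (allVecsOf Ω t) weights                    ≡⟨ weights-∑ t ⟩
        W ^ t                                        ∎
        where
        pointwise : ∀ v → 𝟙 (bad v) * 30 ^ t ≤ weights v
        pointwise v with bad v in isBad
        ... | true  = ≤-trans (≤-reflexive (*-identityˡ (30 ^ t))) (minority⇒heavy v (bad⇒minority v isBad))
        ... | false = z≤n
      W+11G : W + 11 * G ≡ length Ω * 36
      W+11G = trans (cong (W +_) (sym (∑-*ˡ Ω 11 (𝟙 ∘ g)))) (trans (sym (∑-distrib-+ Ω _ _)) (trans (∑-cong Ω total) (∑-const Ω 36)))
        where
        total : ∀ x → weight (g x) + 11 * 𝟙 (g x) ≡ 36
        total x with g x
        ... | true  = refl
        ... | false = refl
      5W≤147N : 5 * W ≤ 3 * (49 * length Ω)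
      5W≤147N = +-cancelʳ-≤ (33 * length Ω) _ _ (begin
        5 * W + 33 * length Ω         ≡⟨ cong (5 * W +_) (*-assoc 11 3 (length Ω)) ⟩
        5 * W + 11 * (3 * length Ω)   ≤⟨ +-monoʳ-≤ (5 * W) (*-monoʳ-≤ 11 3N≤5G) ⟩
        5 * W + 11 * (5 * G)          ≡⟨ collect W G ⟩
        5 * (W + 11 * G)              ≡⟨ cong (5 *_) W+11G ⟩
        5 * (length Ω * 36)           ≡⟨ expand (length Ω) ⟩
        3 * (49 * length Ω) + 33 * length Ω ∎)
        where
        collect : ∀ w g → 5 * w + 11 * (5 * g) ≡ 5 * (w + 11 * g)
        collect = solve-∀
        expand : ∀ n → 5 * (n * 36) ≡ 3 * (49 * n) + 33 * n
        expand = solve-∀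

-- Embedding of ℕ into ℚ, powers and reciprocals

module RationalArithmetic where

  open import Data.Nat as ℕ using (zero; suc; z≤n)
  open import Data.Integer as ℤ using (+_)
  import Data.Integer.Properties as ℤ
  open import Data.Rational as ℚ using (ℚ; 0ℚ; 1ℚ; _+_; _*_; _<_; _≤_; toℚᵘ)
  open import Data.Rational.Properties
  import Data.Rational.Unnormalised as ℚᵘ
  import Data.Rational.Unnormalised.Properties as ℚᵘ

  private
    fromℕᵘ : ℕ → ℚᵘ.ℚᵘ
    fromℕᵘ n = ℚᵘ.mkℚᵘ (+ n) 0

    toℚᵘ-ℕ→ℚ : ∀ n → toℚᵘ (ℕ→ℚ n) ℚᵘ.≃ fromℕᵘ n
    toℚᵘ-ℕ→ℚ n = toℚᵘ-fromℚᵘ (fromℕᵘ n)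

  -- The detour through unnormalised fractions keeps every denominator equal to 1, whereas the
  -- operations of ℚ normalise by a gcd.
  ℕ→ℚ-+ : ∀ m n → ℕ→ℚ (m ℕ.+ n) ≡ ℕ→ℚ m + ℕ→ℚ n
  ℕ→ℚ-+ m n = toℚᵘ-injective (begin
    toℚᵘ (ℕ→ℚ (m ℕ.+ n))            ≈⟨ toℚᵘ-ℕ→ℚ (m ℕ.+ n) ⟩
    fromℕᵘ (m ℕ.+ n)                ≈⟨ ℚᵘ.*≡* (cong₂ ℤ._*_ (sym (cong₂ ℤ._+_ (ℤ.*-identityʳ (+ m)) (ℤ.*-identityʳ (+ n)))) refl) ⟩
    fromℕᵘ m ℚᵘ.+ fromℕᵘ n          ≈⟨ ℚᵘ.+-cong (toℚᵘ-ℕ→ℚ m) (toℚᵘ-ℕ→ℚ n) ⟨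
    toℚᵘ (ℕ→ℚ m) ℚᵘ.+ toℚᵘ (ℕ→ℚ n)  ≈⟨ toℚᵘ-homo-+ (ℕ→ℚ m) (ℕ→ℚ n) ⟨
    toℚᵘ (ℕ→ℚ m + ℕ→ℚ n)            ∎)
    where open ℚᵘ.≃-Reasoning

  ℕ→ℚ-* : ∀ m n → ℕ→ℚ (m ℕ.* n) ≡ ℕ→ℚ m * ℕ→ℚ n
  ℕ→ℚ-* m n = toℚᵘ-injective (begin
    toℚᵘ (ℕ→ℚ (m ℕ.* n))            ≈⟨ toℚᵘ-ℕ→ℚ (m ℕ.* n) ⟩
    fromℕᵘ (m ℕ.* n)                ≈⟨ ℚᵘ.*≡* (cong₂ ℤ._*_ (ℤ.pos-* m n) refl) ⟩
    fromℕᵘ m ℚᵘ.* fromℕᵘ n          ≈⟨ ℚᵘ.*-cong (toℚᵘ-ℕ→ℚ m) (toℚᵘ-ℕ→ℚ n) ⟨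
    toℚᵘ (ℕ→ℚ m) ℚᵘ.* toℚᵘ (ℕ→ℚ n)  ≈⟨ toℚᵘ-homo-* (ℕ→ℚ m) (ℕ→ℚ n) ⟨
    toℚᵘ (ℕ→ℚ m * ℕ→ℚ n)            ∎)
    where open ℚᵘ.≃-Reasoning

  ℕ→ℚ-mono : ∀ {m n} → m ℕ.≤ n → ℕ→ℚ m ≤ ℕ→ℚ n
  ℕ→ℚ-mono {m} {n} m≤n = toℚᵘ-cancel-≤ (begin
    toℚᵘ (ℕ→ℚ m) ≃⟨ toℚᵘ-ℕ→ℚ m ⟩
    fromℕᵘ m     ≤⟨ ℚᵘ.*≤* (ℤ.*-monoʳ-≤-nonNeg (+ 1) (ℤ.+≤+ m≤n)) ⟩
    fromℕᵘ n     ≃⟨ toℚᵘ-ℕ→ℚ n ⟨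
    toℚᵘ (ℕ→ℚ n) ∎)
    where open ℚᵘ.≤-Reasoning

  ℕ→ℚ-cancel-≤ : ∀ {m n} → ℕ→ℚ m ≤ ℕ→ℚ n → m ℕ.≤ n
  ℕ→ℚ-cancel-≤ {m} {n} m≤n with begin
    fromℕᵘ m     ≃⟨ toℚᵘ-ℕ→ℚ m ⟨
    toℚᵘ (ℕ→ℚ m) ≤⟨ toℚᵘ-mono-≤ m≤n ⟩
    toℚᵘ (ℕ→ℚ n) ≃⟨ toℚᵘ-ℕ→ℚ n ⟩
    fromℕᵘ n     ∎
    where open ℚᵘ.≤-Reasoning
  ... | ℚᵘ.*≤* le = ℤ.drop‿+≤+ (ℤ.*-cancelʳ-≤-pos (+ m) (+ n) (+ 1) le)

  0≤ℕ→ℚ : ∀ n → 0ℚ ≤ ℕ→ℚ n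
  0≤ℕ→ℚ n = ℕ→ℚ-mono {0} {n} z≤n

  *-monoˡ : ∀ {a b c} → 0ℚ ≤ a → b ≤ c → a * b ≤ a * c
  *-monoˡ {a} 0≤a = *-monoˡ-≤-nonNeg a {{ℚ.nonNegative 0≤a}}

  *-monoʳ : ∀ {a b c} → 0ℚ ≤ a → b ≤ c → b * a ≤ c * a
  *-monoʳ {a} 0≤a = *-monoʳ-≤-nonNeg a {{ℚ.nonNegative 0≤a}}

  *-mono : ∀ {a b c d} → 0ℚ ≤ b → 0ℚ ≤ c → a ≤ b → c ≤ d → a * c ≤ b * d
  *-mono 0≤b 0≤c a≤b c≤d = ≤-trans (*-monoʳ 0≤c a≤b) (*-monoˡ 0≤b c≤d)

  0≤* : ∀ {a b} → 0ℚ ≤ a → 0ℚ ≤ b → 0ℚ ≤ a * b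
  0≤* {a} {b} 0≤a 0≤b = subst (_≤ a * b) (*-zeroʳ a) (*-monoˡ 0≤a 0≤b)

  0<* : ∀ {a b} → 0ℚ < a → 0ℚ < b → 0ℚ < a * b
  0<* {a} {b} 0<a 0<b = subst (_< a * b) (*-zeroʳ a) (*-monoʳ-<-pos a {{ℚ.positive 0<a}} 0<b)

  ^ℚ-pos : ∀ {a} → 0ℚ < a → ∀ n → 0ℚ < a ^ℚ n
  ^ℚ-pos 0<a zero    = positive⁻¹ 1ℚ
  ^ℚ-pos 0<a (suc n) = 0<* 0<a (^ℚ-pos 0<a n)

  ^ℚ-mono-< : ∀ {a b} → 0ℚ ≤ a → a < b → ∀ n → a ^ℚ suc n < b ^ℚ suc n
  ^ℚ-mono-< 0≤a a<b zero    = *-monoˡ-<-pos 1ℚ a<b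
  ^ℚ-mono-< {a} {b} 0≤a a<b (suc n) = ≤-<-trans (*-monoˡ 0≤a (<⇒≤ (^ℚ-mono-< 0≤a a<b n)))
    (*-monoˡ-<-pos (b ^ℚ suc n) {{ℚ.positive (^ℚ-pos (≤-<-trans 0≤a a<b) (suc n))}} a<b)

  -- Takes the place of roots: √e and log₂ enter `IsPivot` and `IsT` through a squared inequality
  -- and a 35th power.
  ^ℚ-cancel-≤ : ∀ {a b} n → 0ℚ ≤ b → a ^ℚ suc n ≤ b ^ℚ suc n → a ≤ b
  ^ℚ-cancel-≤ {a} {b} n 0≤b aⁿ≤bⁿ with a ≤? b
  ... | yes a≤b = a≤b
  ... | no  a≰b = ⊥-elim (<-irrefl refl (<-≤-trans (^ℚ-mono-< 0≤b (≰⇒> a≰b) n) aⁿ≤bⁿ))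

  ^ℚ-distrib-* : ∀ a b n → (a * b) ^ℚ n ≡ a ^ℚ n * b ^ℚ n
  ^ℚ-distrib-* a b zero    = refl
  ^ℚ-distrib-* a b (suc n) = trans (cong (a * b *_) (^ℚ-distrib-* a b n))
    (solve 4 (λ a b x y → (a :* b) :* (x :* y) := (a :* x) :* (b :* y)) refl a b (a ^ℚ n) (b ^ℚ n))
    where open +-*-Solver

  ℕ→ℚ-^ : ∀ m n → ℕ→ℚ (m ℕ.^ n) ≡ ℕ→ℚ m ^ℚ n
  ℕ→ℚ-^ m zero    = refl
  ℕ→ℚ-^ m (suc n) = trans (ℕ→ℚ-* m (m ℕ.^ n)) (cong (ℕ→ℚ m *_) (ℕ→ℚ-^ m n))

  *-inverse-pos : ∀ a (0<a : 0ℚ < a) → a * 1/pos a 0<a ≡ 1ℚ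
  *-inverse-pos a 0<a = *-inverseʳ a {{ℚ.>-nonZero 0<a}}

  0<1/pos : ∀ a (0<a : 0ℚ < a) → 0ℚ < 1/pos a 0<a
  0<1/pos a 0<a = positive⁻¹ _ {{1/pos⇒pos a {{ℚ.positive 0<a}}}}

  module Reciprocal (a : ℚ) (0<a : 0ℚ < a) where
    private a⁻¹ = 1/pos a 0<a

    a*a⁻¹*x : ∀ x → a * (a⁻¹ * x) ≡ x
    a*a⁻¹*x x = trans (sym (*-assoc a a⁻¹ x)) (trans (cong (_* x) (*-inverse-pos a 0<a)) (*-identityˡ x))

    a⁻¹*a*x : ∀ x → a⁻¹ * (a * x) ≡ x
    a⁻¹*a*x x = trans (sym (*-assoc a⁻¹ a x)) (trans (cong (_* x) (trans (*-comm a⁻¹ a) (*-inverse-pos a 0<a))) (*-identityˡ x))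

    ≤-divide : ∀ {x y} → a * x ≤ y → x ≤ a⁻¹ * y
    ≤-divide {x} {y} ax≤y = subst (_≤ a⁻¹ * y) (a⁻¹*a*x x) (*-monoˡ (<⇒≤ (0<1/pos a 0<a)) ax≤y)

    divide-≤ : ∀ {x y} → x ≤ a * y → a⁻¹ * x ≤ y
    divide-≤ {x} {y} x≤ay = subst (a⁻¹ * x ≤_) (a⁻¹*a*x y) (*-monoˡ (<⇒≤ (0<1/pos a 0<a)) x≤ay)

    multiply-≤ : ∀ {x y} → x ≤ a⁻¹ * y → a * x ≤ y
    multiply-≤ {x} {y} x≤ = subst (a * x ≤_) (a*a⁻¹*x y) (*-monoˡ (<⇒≤ 0<a) x≤)

    unmultiply-≤ : ∀ {x y} → a⁻¹ * x ≤ y → x ≤ a * y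
    unmultiply-≤ {x} {y} ≤y = subst (_≤ a * y) (a*a⁻¹*x x) (*-monoˡ (<⇒≤ 0<a) ≤y)

-- Medians of lists with a majority in an interval

module Medians where

  open CoreAlgorithm using (countTrue≤length; accepts)
  open RationalArithmetic using (ℕ→ℚ-mono)
  open import Data.List.Relation.Binary.Permutation.Propositional using (_↭_)
  open import Data.List.Relation.Binary.Permutation.Propositional.Properties using (↭-length)
  open import Data.List.Relation.Unary.All as All using (All; []; _∷_)
  open import Data.List.Relation.Unary.AllPairs using (AllPairs; []; _∷_)
  open import Data.List.Relation.Unary.Sorted.TotalOrder.Properties using (Sorted⇒AllPairs)
  open import Data.Nat using (zero; suc; _+_; _*_; _∸_; _≤_; _<_; z≤n; s≤s; >-nonZero; _≡ᵇ_)
  open import Data.Nat.DivMod using (_/_; _%_; m≡m%n+[m/n]*n; m%n<n; m/n*n≤m; m/n<m)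
  open import Data.Nat.Properties
  open import Data.List.Sort ≤-decTotalOrder using (sort; sort-↭; sort-↗)
  open import Data.Rational as ℚ using (ℚ; ½)
  import Data.Rational.Properties as ℚ

  countTrue-↭ : ∀ {A : Set} (p : A → Bool) {xs ys} → xs ↭ ys → countTrue p xs ≡ countTrue p ys
  countTrue-↭ p _↭_.refl = refl
  countTrue-↭ p (_↭_.prep x r) with p x
  ... | true  = cong suc (countTrue-↭ p r)
  ... | false = countTrue-↭ p r
  countTrue-↭ p (_↭_.swap x y r) with p x | p y
  ... | true  | true  = cong (suc ∘ suc) (countTrue-↭ p r)
  ... | true  | false = cong suc (countTrue-↭ p r)
  ... | false | true  = cong suc (countTrue-↭ p r)
  ... | false | false = countTrue-↭ p r
  countTrue-↭ p (_↭_.trans r s) = trans (countTrue-↭ p r) (countTrue-↭ p s)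

  countTrue-none : ∀ {A : Set} (p : A → Bool) {xs} → All (λ x → p x ≡ false) xs → countTrue p xs ≡ 0
  countTrue-none p []         = refl
  countTrue-none p (px ∷ pxs) rewrite px = countTrue-none p pxs

  All-nth : ∀ {P : ℕ → Set} {xs} → All P xs → ∀ i → i < length xs → P (nth xs i)
  All-nth (p ∷ ps) zero    _       = p
  All-nth (p ∷ ps) (suc i) (s≤s i<) = All-nth ps i i<

  module _ (p : ℕ → Bool) where

    -- By upward closure, failure at index i forces failure at all i + 1 indices up to i.
    count-above-nth : (∀ {x y} → x ≤ y → p x ≡ true → p y ≡ true) → ∀ {xs} → AllPairs _≤_ xs →
      ∀ i → i < length xs → p (nth xs i) ≡ false → countTrue p xs + suc i ≤ length xs
    count-above-nth up {x ∷ xs} (x≤ ∷ sorted) zero i< px≡f rewrite px≡f =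
      ≤-trans (≤-reflexive (+-comm _ 1)) (s≤s (countTrue≤length p xs))
    count-above-nth up {x ∷ xs} (x≤ ∷ sorted) (suc i) (s≤s i<) py≡f with p x in px
    ... | false = ≤-trans (≤-reflexive (+-suc _ (suc i))) (s≤s (count-above-nth up sorted i i< py≡f))
    ... | true  with trans (sym (up (All-nth x≤ i i<) px)) py≡f
    ...   | ()

    -- By downward closure, failure at index i forces failure from i onwards, which leaves only the
    -- i entries before it.
    count-below-nth : (∀ {x y} → x ≤ y → p y ≡ true → p x ≡ true) → ∀ {xs} → AllPairs _≤_ xs →
      ∀ i → i < length xs → p (nth xs i) ≡ false → countTrue p xs ≤ i
    count-below-nth down {x ∷ xs} (x≤ ∷ sorted) zero i< px≡f rewrite px≡f =
      ≤-reflexive (countTrue-none p (All.map fails x≤))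
      where
      fails : ∀ {y} → x ≤ y → p y ≡ false
      fails {y} x≤y with p y in py
      ... | false = refl
      ... | true  = trans (sym (down x≤y py)) px≡f
    count-below-nth down {x ∷ xs} (x≤ ∷ sorted) (suc i) (s≤s i<) py≡f with p x
    ... | true  = s≤s (count-below-nth down sorted i i< py≡f)
    ... | false = m≤n⇒m≤1+n (count-below-nth down sorted i i< py≡f)

  countTrue-mono : ∀ {A : Set} {p q : A → Bool} → (∀ x → p x ≡ true → q x ≡ true) → ∀ xs → countTrue p xs ≤ countTrue q xs
  countTrue-mono p⇒q [] = z≤n
  countTrue-mono {p = p} {q} p⇒q (x ∷ xs) with p x in px
  ... | true rewrite p⇒q x px = s≤s (countTrue-mono p⇒q xs)
  ... | false with q x
  ...   | true  = m≤n⇒m≤1+n (countTrue-mono p⇒q xs)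
  ...   | false = countTrue-mono p⇒q xs

  does⇒ : ∀ {A : Set} (a? : Dec A) → does a? ≡ true → A
  does⇒ (yes a) _ = a

  ∧-trueˡ : ∀ {a b} → a ∧ b ≡ true → a ≡ true
  ∧-trueˡ {true} _ = refl

  ∧-trueʳ : ∀ {a b} → a ∧ b ≡ true → b ≡ true
  ∧-trueʳ {true} b≡t = b≡t

  module _ (lo hi : ℚ) where

    within : ℚ → Bool
    within q = does (lo ℚ.≤? q) ∧ does (q ℚ.≤? hi)

    -- An interval is the intersection of an upward and a downward closed set, so its two ends are
    -- treated separately: too many entries lie within for entry i to violate either.
    nth-within : ∀ {xs} → AllPairs _≤_ xs → ∀ i → i < length xs →
      length xs < countTrue (within ∘ ℕ→ℚ) xs + suc i → i < countTrue (within ∘ ℕ→ℚ) xs →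
      lo ℚ.≤ ℕ→ℚ (nth xs i) × ℕ→ℚ (nth xs i) ℚ.≤ hi
    nth-within {xs} sorted i i<k many₁ many₂ = above , below
      where
      p q : ℕ → Bool
      p c = does (lo ℚ.≤? ℕ→ℚ c)
      q c = does (ℕ→ℚ c ℚ.≤? hi)
      above : lo ℚ.≤ ℕ→ℚ (nth xs i)
      above with p (nth xs i) in eq
      ... | true  = does⇒ (lo ℚ.≤? _) eq
      ... | false = ⊥-elim (<⇒≱ many₁ (≤-trans (+-monoˡ-≤ (suc i) (countTrue-mono (λ c → ∧-trueˡ) xs))
                      (count-above-nth p (λ x≤y px → dec-true (lo ℚ.≤? _) (ℚ.≤-trans (does⇒ (lo ℚ.≤? _) px) (ℕ→ℚ-mono x≤y))) sorted i i<k eq)))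
      below : ℕ→ℚ (nth xs i) ℚ.≤ hi
      below with q (nth xs i) in eq
      ... | true  = does⇒ (_ ℚ.≤? hi) eq
      ... | false = ⊥-elim (<⇒≱ many₂ (≤-trans (countTrue-mono (λ c → ∧-trueʳ) xs)
                      (count-below-nth q (λ x≤y qy → dec-true (_ ℚ.≤? hi) (ℚ.≤-trans (ℕ→ℚ-mono x≤y) (does⇒ (_ ℚ.≤? hi) qy))) sorted i i<k eq)))

    private
      average-within : ∀ {p q} → lo ℚ.≤ p × p ℚ.≤ hi → lo ℚ.≤ q × q ℚ.≤ hi →
        lo ℚ.≤ (p ℚ.+ q) ℚ.* ½ × (p ℚ.+ q) ℚ.* ½ ℚ.≤ hi
      average-within {p} {q} (lo≤p , p≤hi) (lo≤q , q≤hi) =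
        subst (ℚ._≤ (p ℚ.+ q) ℚ.* ½) (halve lo) (ℚ.*-monoʳ-≤-nonNeg ½ (ℚ.+-mono-≤ lo≤p lo≤q)) ,
        subst ((p ℚ.+ q) ℚ.* ½ ℚ.≤_) (halve hi) (ℚ.*-monoʳ-≤-nonNeg ½ (ℚ.+-mono-≤ p≤hi q≤hi))
        where
        halve : ∀ r → (r ℚ.+ r) ℚ.* ½ ≡ r
        halve r = trans (ℚ.*-distribʳ-+ ½ r r) (trans (sym (ℚ.*-distribˡ-+ r ½ ½)) (ℚ.*-identityʳ r))

      within-intro : ∀ {q} → lo ℚ.≤ q × q ℚ.≤ hi → within q ≡ true
      within-intro {q} (lo≤q , q≤hi) = cong₂ _∧_ (dec-true (lo ℚ.≤? q) lo≤q) (dec-true (q ℚ.≤? hi) q≤hi)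

    withinMaybe : Maybe ℚ → Bool
    withinMaybe nothing  = false
    withinMaybe (just q) = within q

    private
      -- The body of `median` with the length as a separate argument, so that k can be matched on
      -- while its link to the list remains an equation.
      middle : List ℕ → ℕ → Maybe ℚ
      middle ys k =
        if k ≡ᵇ 0 then nothing
        else if k % 2 ≡ᵇ 0
          then just ((ℕ→ℚ (nth ys (k / 2 ∸ 1)) ℚ.+ ℕ→ℚ (nth ys (k / 2))) ℚ.* ½)
          else just (ℕ→ℚ (nth ys (k / 2)))

      module _ {ys : List ℕ} (sorted : AllPairs _≤_ ys) (k : ℕ) (k≡ : k ≡ length ys) (k>0 : 0 < k) where
        c = countTrue (within ∘ ℕ→ℚ) ys
        h = k / 2

        k≡h : k ≡ k % 2 + h * 2
        k≡h = m≡m%n+[m/n]*n k 2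

        h<k : h < k
        h<k = m/n<m k 2 {{>-nonZero k>0}} (s≤s (s≤s z≤n))

        upper-middle : k < 2 * c → lo ℚ.≤ ℕ→ℚ (nth ys h) × ℕ→ℚ (nth ys h) ℚ.≤ hi
        upper-middle majority = nth-within sorted h (subst (h <_) k≡ h<k)
          (subst (_< c + suc h) k≡ (begin-strict
            k              ≡⟨ k≡h ⟩
            k % 2 + h * 2  ≤⟨ +-monoˡ-≤ (h * 2) (≤-pred (m%n<n k 2)) ⟩
            1 + h * 2      ≡⟨ cong suc (trans (*-comm h 2) (cong (h +_) (+-identityʳ h))) ⟩
            suc h + h      <⟨ +-monoʳ-< (suc h) h<c ⟩
            suc h + c      ≡⟨ +-comm (suc h) c ⟩
            c + suc h      ∎))
          h<c
          where
          open ≤-Reasoning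
          h<c : h < c
          h<c = *-cancelʳ-< 2 h c (begin-strict
            h * 2 ≤⟨ m/n*n≤m k 2 ⟩
            k     <⟨ majority ⟩
            2 * c ≡⟨ *-comm 2 c ⟩
            c * 2 ∎)

        lower-middle : k % 2 ≡ 0 → k < 2 * c → lo ℚ.≤ ℕ→ℚ (nth ys (h ∸ 1)) × ℕ→ℚ (nth ys (h ∸ 1)) ℚ.≤ hi
        lower-middle even majority = nth-within sorted (h ∸ 1) (subst (h ∸ 1 <_) k≡ (≤-<-trans (m∸n≤m h 1) h<k))
          (subst (_< c + suc (h ∸ 1)) k≡ (begin-strict
            k               ≡⟨ k≡2h ⟩
            h * 2           ≡⟨ trans (*-comm h 2) (cong (h +_) (+-identityʳ h)) ⟩
            h + h           <⟨ +-monoˡ-< h h<c ⟩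
            c + h           ≡⟨ cong (c +_) (sym h≡) ⟩
            c + suc (h ∸ 1) ∎))
          (≤-<-trans (m∸n≤m h 1) h<c)
          where
          open ≤-Reasoning
          k≡2h : k ≡ h * 2
          k≡2h = trans k≡h (cong (_+ h * 2) even)
          -- The subtraction does not truncate: k is positive and even, so h ≥ 1.
          h≡ : suc (h ∸ 1) ≡ h
          h≡ with h | k≡2h
          ... | zero  | k≡0 = ⊥-elim (<⇒≱ k>0 (≤-reflexive k≡0))
          ... | suc _ | _   = refl
          h<c : h < c
          h<c = *-cancelʳ-< 2 h c (begin-strict
            h * 2 ≡⟨ sym k≡2h ⟩
            k     <⟨ majority ⟩
            2 * c ≡⟨ *-comm 2 c ⟩
            c * 2 ∎)

      middle-within : ∀ {ys} → AllPairs _≤_ ys → ∀ k → k ≡ length ys → k < 2 * countTrue (within ∘ ℕ→ℚ) ys →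
        withinMaybe (middle ys k) ≡ true
      middle-within {ys} sorted zero k≡ majority =
        ⊥-elim (<⇒≱ majority (*-monoʳ-≤ 2 (≤-trans (countTrue≤length (within ∘ ℕ→ℚ) ys) (≤-reflexive (sym k≡)))))
      middle-within {ys} sorted k@(suc _) k≡ majority with k % 2 ≡ᵇ 0 in parity
      ... | false = within-intro (upper-middle sorted k k≡ (s≤s z≤n) majority)
      ... | true  = within-intro (average-within (lower-middle sorted k k≡ (s≤s z≤n) (≡ᵇ⇒≡ (k % 2) 0 (subst Bool.T (sym parity) tt)) majority)
                                                 (upper-middle sorted k k≡ (s≤s z≤n) majority))

    median-within : ∀ xs → length xs < 2 * countTrue (within ∘ ℕ→ℚ) xs → withinMaybe (median xs) ≡ true
    median-within xs majority = middle-within (Sorted⇒AllPairs ≤-totalOrder (sort-↗ xs)) (length (sort xs)) refl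
      (subst (_< 2 * countTrue (within ∘ ℕ→ℚ) (sort xs)) (sym (↭-length (sort-↭ xs)))
        (subst (λ c → length xs < 2 * c) (sym (countTrue-↭ _ (sort-↭ xs))) majority))

  countTrue-catMaybes : ∀ {A : Set} (f : A → Maybe ℕ) (good : ℕ → Bool) {t} (v : Vec A t) →
    countTrue good (catMaybes (Vec.toList (Vec.map f v))) ≡ countTrue (accepts good ∘ f) (Vec.toList v)
  countTrue-catMaybes f good []      = refl
  countTrue-catMaybes f good (x ∷ v) with f x
  ... | nothing = countTrue-catMaybes f good v
  ... | just c with good c
  ...   | true  = cong suc (countTrue-catMaybes f good v)
  ...   | false = countTrue-catMaybes f good v

  length-catMaybes≤ : ∀ {A B : Set} (f : A → Maybe B) {t} (v : Vec A t) → length (catMaybes (Vec.toList (Vec.map f v))) ≤ t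
  length-catMaybes≤ f []      = z≤n
  length-catMaybes≤ f (x ∷ v) with f x
  ... | nothing = m≤n⇒m≤1+n (length-catMaybes≤ f v)
  ... | just _  = s≤s (length-catMaybes≤ f v)

open CoreAlgorithm
open RationalArithmetic
open Medians
open import Data.Nat as ℕ using (suc; ∣_-_∣)
import Data.Nat.Properties as ℕ
open import Data.Rational as ℚ using (ℚ; 0ℚ; 1ℚ; _<_; _≤_; _-_; _+_; _*_)
open import Data.Rational.Properties

-- What the choice of pivot provides

module _ (ε : ℚ) (ε>0 : 0ℚ < ε) where

  private
    κ = 1ℚ + 1/pos ε ε>0
    X = κ ^ℚ 2

    0≤1/ε : 0ℚ ≤ 1/pos ε ε>0
    0≤1/ε = <⇒≤ (0<1/pos ε ε>0)

    0≤κ : 0ℚ ≤ κ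
    0≤κ = +-mono-≤ (nonNegative⁻¹ 1ℚ) 0≤1/ε

    0≤X : 0ℚ ≤ X
    0≤X = 0≤* 0≤κ (0≤* 0≤κ (nonNegative⁻¹ 1ℚ))

    -- 89² ≤ 18² · 9 (1 + 1 + 1/2! + ⋯ + 1/5!), which is where the constant 9/89 ≈ 1/(6 √e) comes from.
    89X≤18k : ∀ k → 3√e* X ≤ k → ℕ→ℚ 89 * X ≤ ℕ→ℚ 18 * ℕ→ℚ k
    89X≤18k k ceil = ^ℚ-cancel-≤ 1 (0≤* (0≤ℕ→ℚ 18) (0≤ℕ→ℚ k)) (begin
      (ℕ→ℚ 89 * X) ^ℚ 2                          ≡⟨ square (ℕ→ℚ 89) X ⟩
      (ℕ→ℚ 89 * ℕ→ℚ 89) * (X * X)                ≤⟨ *-monoʳ (0≤* 0≤X 0≤X) (toWitness {a? = ℕ→ℚ 89 * ℕ→ℚ 89 ≤? (ℕ→ℚ 18 * ℕ→ℚ 18) * (ℕ→ℚ 9 * expSum 5)} tt) ⟩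
      (ℕ→ℚ 18 * ℕ→ℚ 18) * (ℕ→ℚ 9 * expSum 5) * (X * X) ≡⟨ *-assoc (ℕ→ℚ 18 * ℕ→ℚ 18) (ℕ→ℚ 9 * expSum 5) (X * X) ⟩
      (ℕ→ℚ 18 * ℕ→ℚ 18) * (ℕ→ℚ 9 * expSum 5 * (X * X)) ≤⟨ *-monoˡ (0≤* (0≤ℕ→ℚ 18) (0≤ℕ→ℚ 18)) (ceil 5) ⟩
      (ℕ→ℚ 18 * ℕ→ℚ 18) * ℕ→ℚ (k ℕ.* k)          ≡⟨ cong ((ℕ→ℚ 18 * ℕ→ℚ 18) *_) (ℕ→ℚ-* k k) ⟩
      (ℕ→ℚ 18 * ℕ→ℚ 18) * (ℕ→ℚ k * ℕ→ℚ k)        ≡⟨ sym (square (ℕ→ℚ 18) (ℕ→ℚ k)) ⟩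
      (ℕ→ℚ 18 * ℕ→ℚ k) ^ℚ 2                      ∎)
      where
      open ≤-Reasoning
      square : ∀ a b → (a * b) ^ℚ 2 ≡ (a * a) * (b * b)
      square a b = trans (cong ((a * b) *_) (*-identityʳ (a * b)))
        (solve 2 (λ a b → (a :* b) :* (a :* b) := (a :* a) :* (b :* b)) refl a b)
        where open +-*-Solver

    4≤X : ε ≤ 1ℚ → ℕ→ℚ 4 ≤ X
    4≤X ε≤1 = *-mono {ℕ→ℚ 2} {κ} {ℕ→ℚ 2 * 1ℚ} 0≤κ (0≤ℕ→ℚ 2) 2≤κ (*-monoʳ (nonNegative⁻¹ 1ℚ) 2≤κ)
      where
      2≤κ : ℕ→ℚ 2 ≤ κ
      2≤κ = +-monoʳ-≤ 1ℚ {1ℚ} {1/pos ε ε>0} (subst (1ℚ ≤_) (*-identityʳ (1/pos ε ε>0)) (Reciprocal.≤-divide ε ε>0 (subst (_≤ 1ℚ) (sym (*-identityʳ ε)) ε≤1)))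

  pivot≥40 : ε ≤ 1ℚ → ∀ pivot → IsPivot ε ε>0 pivot → 40 ℕ.≤ pivot
  pivot≥40 ε≤1 .(2 ℕ.* k) (k , (ceil , _) , refl) = ℕ.*-monoʳ-≤ 2 20≤k
    where
    89*4≤18k : 89 ℕ.* 4 ℕ.≤ 18 ℕ.* k
    89*4≤18k = ℕ→ℚ-cancel-≤ (≤-trans (*-monoˡ (0≤ℕ→ℚ 89) (4≤X ε≤1))
      (subst (ℕ→ℚ 89 * X ≤_) (sym (ℕ→ℚ-* 18 k)) (89X≤18k k ceil)))
    20≤k : 20 ℕ.≤ k
    20≤k with 20 ℕ.≤? k
    ... | yes 20≤k = 20≤k
    -- k ≤ 19 would give 18 k ≤ 342, but 89 · 4 = 356.
    ... | no  20≰k = ⊥-elim (ℕ.<⇒≱ (ℕ.≤ᵇ⇒≤ (suc (18 ℕ.* 19)) (89 ℕ.* 4) tt)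
                       (ℕ.≤-trans 89*4≤18k (ℕ.*-monoʳ-≤ 18 (ℕ.≤-pred (ℕ.≰⇒> 20≰k)))))

  lower upper : ℕ → ℚ
  lower R = 1/pos (1ℚ + ε) (1+ε>0 ε ε>0) * ℕ→ℚ R
  upper R = (1ℚ + ε) * ℕ→ℚ R

  private
    x≤[1+ε]x : ∀ {x} → 0ℚ ≤ x → x ≤ (1ℚ + ε) * x
    x≤[1+ε]x {x} 0≤x = subst (_≤ (1ℚ + ε) * x) (*-identityˡ x)
      (*-monoʳ 0≤x (subst (_≤ 1ℚ + ε) (+-identityʳ 1ℚ) (+-monoʳ-≤ 1ℚ (<⇒≤ ε>0))))

    [1+ε]x : ∀ x → (1ℚ + ε) * x ≡ x + ε * x
    [1+ε]x x = trans (*-distribʳ-+ x 1ℚ ε) (cong (_+ ε * x) (*-identityˡ x))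

    κx : ∀ x → κ * x ≡ x + 1/pos ε ε>0 * x
    κx x = trans (*-distribʳ-+ x 1ℚ (1/pos ε ε>0)) (cong (_+ 1/pos ε ε>0 * x) (*-identityˡ x))

    [1+ε]x≤x+y⇒x≤y/ε : ∀ {x y} → (1ℚ + ε) * x ≤ x + y → x ≤ 1/pos ε ε>0 * y
    [1+ε]x≤x+y⇒x≤y/ε {x} {y} h = Reciprocal.≤-divide ε ε>0 (+-cancelˡ-≤ x (subst (_≤ x + y) ([1+ε]x x) h))
      where
      +-cancelˡ-≤ : ∀ x {y z} → x + y ≤ x + z → y ≤ z
      +-cancelˡ-≤ x {y} {z} le = subst₂≤ (cancel y) (cancel z) (+-monoʳ-≤ (ℚ.- x) le)
        where
        cancel : ∀ y → ℚ.- x + (x + y) ≡ y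
        cancel y = trans (sym (+-assoc (ℚ.- x) x y)) (trans (cong (_+ y) (+-inverseˡ x)) (+-identityˡ y))
        subst₂≤ : ∀ {a b c d} → a ≡ b → c ≡ d → a ≤ c → b ≤ d
        subst₂≤ refl refl le = le

    -- Write δ for the distance of c from R. The lower end is the tight one: (1 + ε) c ≤ R = c + δ
    -- gives c ≤ δ / ε, so R ≤ κ δ. At the upper end even R ≤ δ / ε. Thus 1 / κ = ε / (1 + ε) is the
    -- relative error guaranteed on both sides.
    outside⇒r≤κδ : ∀ R c → (ℕ→ℚ c ≤ lower R ⊎ upper R ≤ ℕ→ℚ c) → ℕ→ℚ R ≤ κ * ℕ→ℚ ∣ c - R ∣
    outside⇒r≤κδ R c (inj₁ c≤lower) = begin
      ℕ→ℚ R                                     ≡⟨ r≡ ⟩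
      ℕ→ℚ c + ℕ→ℚ ∣ c - R ∣                     ≤⟨ +-monoˡ-≤ (ℕ→ℚ ∣ c - R ∣) ([1+ε]x≤x+y⇒x≤y/ε (subst ((1ℚ + ε) * ℕ→ℚ c ≤_) r≡ [1+ε]c≤r)) ⟩
      1/pos ε ε>0 * ℕ→ℚ ∣ c - R ∣ + ℕ→ℚ ∣ c - R ∣ ≡⟨ trans (+-comm (1/pos ε ε>0 * ℕ→ℚ ∣ c - R ∣) _) (sym (κx _)) ⟩
      κ * ℕ→ℚ ∣ c - R ∣                         ∎
      where
      open ≤-Reasoning
      [1+ε]c≤r : (1ℚ + ε) * ℕ→ℚ c ≤ ℕ→ℚ R
      [1+ε]c≤r = Reciprocal.multiply-≤ (1ℚ + ε) (1+ε>0 ε ε>0) c≤lower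
      c≤R : c ℕ.≤ R
      c≤R = ℕ→ℚ-cancel-≤ (≤-trans (x≤[1+ε]x (0≤ℕ→ℚ c)) [1+ε]c≤r)
      r≡ : ℕ→ℚ R ≡ ℕ→ℚ c + ℕ→ℚ ∣ c - R ∣
      r≡ = trans (cong ℕ→ℚ (sym (trans (cong (c ℕ.+_) (ℕ.m≤n⇒∣m-n∣≡n∸m c≤R)) (ℕ.m+[n∸m]≡n c≤R)))) (ℕ→ℚ-+ c ∣ c - R ∣)
    outside⇒r≤κδ R c (inj₂ upper≤c) = begin
      ℕ→ℚ R                                     ≤⟨ [1+ε]x≤x+y⇒x≤y/ε (subst ((1ℚ + ε) * ℕ→ℚ R ≤_) c≡ upper≤c) ⟩
      1/pos ε ε>0 * ℕ→ℚ ∣ c - R ∣               ≡⟨ sym (+-identityˡ _) ⟩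
      0ℚ + 1/pos ε ε>0 * ℕ→ℚ ∣ c - R ∣          ≤⟨ +-monoˡ-≤ (1/pos ε ε>0 * ℕ→ℚ ∣ c - R ∣) (0≤ℕ→ℚ ∣ c - R ∣) ⟩
      ℕ→ℚ ∣ c - R ∣ + 1/pos ε ε>0 * ℕ→ℚ ∣ c - R ∣ ≡⟨ sym (κx _) ⟩
      κ * ℕ→ℚ ∣ c - R ∣                         ∎
      where
      open ≤-Reasoning
      R≤c : R ℕ.≤ c
      R≤c = ℕ→ℚ-cancel-≤ (≤-trans (x≤[1+ε]x (0≤ℕ→ℚ R)) upper≤c)
      c≡ : ℕ→ℚ c ≡ ℕ→ℚ R + ℕ→ℚ ∣ c - R ∣
      c≡ = trans (cong ℕ→ℚ (sym (trans (cong (R ℕ.+_) (ℕ.m≤n⇒∣n-m∣≡n∸m R≤c)) (ℕ.m+[n∸m]≡n R≤c)))) (ℕ→ℚ-+ R ∣ c - R ∣)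

    not-within : ∀ lo hi q → within lo hi q ≡ false → q ≤ lo ⊎ hi ≤ q
    not-within lo hi q out with lo ≤? q | q ≤? hi
    ... | no  lo≰q | _         = inj₁ (<⇒≤ (≰⇒> lo≰q))
    ... | yes lo≤q | no  q≰hi  = inj₂ (<⇒≤ (≰⇒> q≰hi))
    ... | yes lo≤q | yes q≤hi  = ⊥-elim (true≢false (trans (sym (cong₂ _∧_ (dec-true (lo ≤? q) lo≤q) (dec-true (q ≤? hi) q≤hi))) out))
      where
      true≢false : true ≡ false → ⊥
      true≢false ()

  outside⇒far : ∀ pivot → IsPivot ε ε>0 pivot → ∀ R c → within (lower R) (upper R) (ℕ→ℚ c) ≡ false →
    89 ℕ.* (R ℕ.* R) ℕ.≤ 9 ℕ.* pivot ℕ.* (∣ c - R ∣ ℕ.* ∣ c - R ∣)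
  outside⇒far .(2 ℕ.* k) (k , (ceil , _) , refl) R c out = ℕ→ℚ-cancel-≤ (begin
    ℕ→ℚ (89 ℕ.* (R ℕ.* R))            ≡⟨ trans (ℕ→ℚ-* 89 (R ℕ.* R)) (cong (ℕ→ℚ 89 *_) (ℕ→ℚ-* R R)) ⟩
    ℕ→ℚ 89 * (ℕ→ℚ R * ℕ→ℚ R)          ≤⟨ *-monoˡ (0≤ℕ→ℚ 89) (*-mono (0≤* 0≤κ (0≤ℕ→ℚ δ)) (0≤ℕ→ℚ R) r≤κδ r≤κδ) ⟩
    ℕ→ℚ 89 * (κ * ℕ→ℚ δ * (κ * ℕ→ℚ δ)) ≡⟨ regroup (ℕ→ℚ 89) κ (ℕ→ℚ δ) ⟩
    ℕ→ℚ 89 * X * (ℕ→ℚ δ * ℕ→ℚ δ)      ≤⟨ *-monoʳ (0≤* (0≤ℕ→ℚ δ) (0≤ℕ→ℚ δ)) (89X≤18k k ceil) ⟩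
    ℕ→ℚ 18 * ℕ→ℚ k * (ℕ→ℚ δ * ℕ→ℚ δ)  ≡⟨ cong₂ _*_ (sym (ℕ→ℚ-* 18 k)) (sym (ℕ→ℚ-* δ δ)) ⟩
    ℕ→ℚ (18 ℕ.* k) * ℕ→ℚ (δ ℕ.* δ)    ≡⟨ sym (ℕ→ℚ-* (18 ℕ.* k) (δ ℕ.* δ)) ⟩
    ℕ→ℚ (18 ℕ.* k ℕ.* (δ ℕ.* δ))      ≡⟨ cong (λ x → ℕ→ℚ (x ℕ.* (δ ℕ.* δ))) (ℕ.*-assoc 9 2 k) ⟩
    ℕ→ℚ (9 ℕ.* (2 ℕ.* k) ℕ.* (δ ℕ.* δ)) ∎)
    where
    open ≤-Reasoning
    δ = ∣ c - R ∣
    r≤κδ : ℕ→ℚ R ≤ κ * ℕ→ℚ δ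
    r≤κδ = outside⇒r≤κδ R c (not-within (lower R) (upper R) (ℕ→ℚ c) out)
    regroup : ∀ a b x → a * (b * x * (b * x)) ≡ a * b ^ℚ 2 * (x * x)
    regroup a b x = trans (solve 3 (λ a b x → a :* (b :* x :* (b :* x)) := a :* (b :* b) :* (x :* x)) refl a b x)
      (cong (λ y → a * (b * y) * (x * x)) (sym (*-identityʳ b)))
      where open +-*-Solver

  exact-within : ∀ R → within (lower R) (upper R) (ℕ→ℚ R) ≡ true
  exact-within R = cong₂ _∧_
    (dec-true (lower R ≤? ℕ→ℚ R) (Reciprocal.divide-≤ (1ℚ + ε) (1+ε>0 ε ε>0) (x≤[1+ε]x (0≤ℕ→ℚ R))))
    (dec-true (ℕ→ℚ R ≤? upper R) (x≤[1+ε]x (0≤ℕ→ℚ R)))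

-- (3/δ · 49^t)^35 ≤ 2^t · 49^(35 t) ≤ 50^(35 t)
iterations-suffice : ∀ δ (δ>0 : 0ℚ < δ) t → IsT δ δ>0 t → ℕ→ℚ (49 ℕ.^ t) ≤ δ * ℕ→ℚ (50 ℕ.^ t)
iterations-suffice δ δ>0 t (enough , _) = ≤-trans a≤3a (Reciprocal.unmultiply-≤ δ δ>0 (subst (_≤ b) (assoc₃ (ℕ→ℚ 3) δ⁻¹ a) root))
  where
  a b δ⁻¹ : ℚ
  a = ℕ→ℚ (49 ℕ.^ t)
  b = ℕ→ℚ (50 ℕ.^ t)
  δ⁻¹ = 1/pos δ δ>0
  assoc₃ : ∀ x y z → x * y * z ≡ y * (x * z)
  assoc₃ = solve 3 (λ x y z → x :* y :* z := y :* (x :* z)) refl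
    where open +-*-Solver
  a≤3a : a ≤ ℕ→ℚ 3 * a
  a≤3a = subst (a ≤_) (ℕ→ℚ-* 3 (49 ℕ.^ t)) (ℕ→ℚ-mono (ℕ.m≤n*m (49 ℕ.^ t) 3))
  numeric : 2 ℕ.^ t ℕ.* (49 ℕ.^ t) ℕ.^ 35 ℕ.≤ (50 ℕ.^ t) ℕ.^ 35
  numeric = begin
    2 ℕ.^ t ℕ.* (49 ℕ.^ t) ℕ.^ 35  ≡⟨ cong (2 ℕ.^ t ℕ.*_) (swap-^ 49) ⟩
    2 ℕ.^ t ℕ.* (49 ℕ.^ 35) ℕ.^ t  ≡⟨ sym (^-distribʳ-* 2 (49 ℕ.^ 35) t) ⟩
    (2 ℕ.* 49 ℕ.^ 35) ℕ.^ t        ≤⟨ ℕ.^-monoˡ-≤ t (ℕ.≤ᵇ⇒≤ (2 ℕ.* 49 ℕ.^ 35) (50 ℕ.^ 35) tt) ⟩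
    (50 ℕ.^ 35) ℕ.^ t              ≡⟨ sym (swap-^ 50) ⟩
    (50 ℕ.^ t) ℕ.^ 35              ∎
    where
    open ℕ.≤-Reasoning
    swap-^ : ∀ x → (x ℕ.^ t) ℕ.^ 35 ≡ (x ℕ.^ 35) ℕ.^ t
    swap-^ x = trans (ℕ.^-*-assoc x t 35) (trans (cong (x ℕ.^_) (ℕ.*-comm t 35)) (sym (ℕ.^-*-assoc x 35 t)))
  root : ℕ→ℚ 3 * δ⁻¹ * a ≤ b
  root = ^ℚ-cancel-≤ 34 (0≤ℕ→ℚ (50 ℕ.^ t)) (begin
    (ℕ→ℚ 3 * δ⁻¹ * a) ^ℚ 35                 ≡⟨ ^ℚ-distrib-* (ℕ→ℚ 3 * δ⁻¹) a 35 ⟩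
    (ℕ→ℚ 3 * δ⁻¹) ^ℚ 35 * a ^ℚ 35           ≤⟨ *-monoʳ (subst (0ℚ ≤_) (ℕ→ℚ-^ (49 ℕ.^ t) 35) (0≤ℕ→ℚ ((49 ℕ.^ t) ℕ.^ 35))) enough ⟩
    ℕ→ℚ (2 ℕ.^ t) * a ^ℚ 35                 ≡⟨ cong (ℕ→ℚ (2 ℕ.^ t) *_) (sym (ℕ→ℚ-^ (49 ℕ.^ t) 35)) ⟩
    ℕ→ℚ (2 ℕ.^ t) * ℕ→ℚ ((49 ℕ.^ t) ℕ.^ 35) ≡⟨ sym (ℕ→ℚ-* (2 ℕ.^ t) ((49 ℕ.^ t) ℕ.^ 35)) ⟩
    ℕ→ℚ (2 ℕ.^ t ℕ.* (49 ℕ.^ t) ℕ.^ 35)     ≤⟨ ℕ→ℚ-mono numeric ⟩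
    ℕ→ℚ ((50 ℕ.^ t) ℕ.^ 35)                 ≡⟨ ℕ→ℚ-^ (50 ℕ.^ t) 35 ⟩
    b ^ℚ 35                                 ∎)
    where open ≤-Reasoning

-- From counts of failures to the probability

failure-bound⇒PrAtLeast : ∀ {A : Set} (Ω : List A) (E : A → Bool) δ →
  ℕ→ℚ (∑ Ω (𝟙 ∘ not ∘ E)) ≤ δ * ℕ→ℚ (length Ω) → PrAtLeast Ω E (1ℚ - δ)
failure-bound⇒PrAtLeast Ω E δ fail≤ = begin
  (1ℚ - δ) * L              ≡⟨ distribute δ L ⟩
  L - δ * L                 ≤⟨ +-monoʳ-≤ L (neg-antimono-≤ fail≤) ⟩
  L - B                     ≡⟨ cong (_- B) L≡ ⟩
  B + ℕ→ℚ (countTrue E Ω) - B ≡⟨ cancel B (ℕ→ℚ (countTrue E Ω)) ⟩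
  ℕ→ℚ (countTrue E Ω)       ∎
  where
  open ≤-Reasoning
  open +-*-Solver
  L B : ℚ
  L = ℕ→ℚ (length Ω)
  B = ℕ→ℚ (∑ Ω (𝟙 ∘ not ∘ E))
  L≡ : L ≡ B + ℕ→ℚ (countTrue E Ω)
  L≡ = trans (cong ℕ→ℚ (trans (length≡∑ Ω) (trans (∑-cong Ω (λ ω → sym (𝟙-not (E ω))))
    (trans (∑-distrib-+ Ω (𝟙 ∘ not ∘ E) (𝟙 ∘ E)) (cong (∑ Ω (𝟙 ∘ not ∘ E) ℕ.+_) (sym (countTrue≡∑ E Ω))))))) (ℕ→ℚ-+ (∑ Ω (𝟙 ∘ not ∘ E)) (countTrue E Ω))
  distribute : ∀ d l → (1ℚ - d) * l ≡ l - d * l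
  distribute = solve 2 (λ d l → (con 1ℚ :- d) :* l := l :- d :* l) refl
  cancel : ∀ b s → b + s - b ≡ s
  cancel = solve 2 (λ b s → b :+ s :- b := s) refl


ratio-bound : ∀ B L a b δ → 0 ℕ.< b → B ℕ.* b ℕ.≤ a ℕ.* L → ℕ→ℚ a ≤ δ * ℕ→ℚ b → ℕ→ℚ B ≤ δ * ℕ→ℚ L
ratio-bound B L a b δ b>0 Bb≤aL a≤δb = *-cancelʳ-≤-pos (ℕ→ℚ b) {{ℚ.positive 0<b}} (begin
  ℕ→ℚ B * ℕ→ℚ b       ≡⟨ sym (ℕ→ℚ-* B b) ⟩
  ℕ→ℚ (B ℕ.* b)       ≤⟨ ℕ→ℚ-mono Bb≤aL ⟩
  ℕ→ℚ (a ℕ.* L)       ≡⟨ ℕ→ℚ-* a L ⟩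
  ℕ→ℚ a * ℕ→ℚ L       ≤⟨ *-monoʳ (0≤ℕ→ℚ L) a≤δb ⟩
  δ * ℕ→ℚ b * ℕ→ℚ L   ≡⟨ swap δ (ℕ→ℚ b) (ℕ→ℚ L) ⟩
  δ * ℕ→ℚ L * ℕ→ℚ b   ∎)
  where
  open ≤-Reasoning
  0<b : 0ℚ < ℕ→ℚ b
  0<b = <-≤-trans (positive⁻¹ 1ℚ) (ℕ→ℚ-mono {1} b>0)
  swap : ∀ x y z → x * y * z ≡ x * z * y
  swap = solve 3 (λ x y z → x :* y :* z := x :* z :* y) refl
    where open +-*-Solver

median-amplification : ∀ {A : Set} (Ω : List A) (f : A → Maybe ℕ) (lo hi : ℚ) t →
  3 ℕ.* length Ω ℕ.≤ 5 ℕ.* ∑ Ω (𝟙 ∘ accepts (within lo hi ∘ ℕ→ℚ) ∘ f) →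
  ∑ (allVecsOf Ω t) (λ v → 𝟙 (not (withinMaybe lo hi (median (catMaybes (Vec.toList (Vec.map f v))))))) ℕ.* 50 ℕ.^ t
    ℕ.≤ 49 ℕ.^ t ℕ.* length (allVecsOf Ω t)
median-amplification {A} Ω f lo hi t = majority-amplification t (λ v → not (success v)) minority
  where
  good : ℕ → Bool
  good = within lo hi ∘ ℕ→ℚ
  open Chernoff Ω (accepts good ∘ f)
  success : Vec A t → Bool
  success v = withinMaybe lo hi (median (catMaybes (Vec.toList (Vec.map f v))))
  not-true : ∀ {b} → not b ≡ true → b ≡ true → ⊥
  not-true {true} ()
  minority : ∀ v → not (success v) ≡ true → 2 ℕ.* hitCount v ℕ.≤ t
  -- Dropping the ⊥ results shortens the list but keeps its good entries, so more than t / 2 good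
  -- calls are a majority of what remains.
  minority v failed = ℕ.≮⇒≥ (λ many → not-true failed
    (median-within lo hi (catMaybes (Vec.toList (Vec.map f v)))
      (ℕ.≤-<-trans (length-catMaybes≤ f v)
        (subst (λ c → t ℕ.< 2 ℕ.* c) (sym (countTrue-catMaybes f good v)) many))))

theorem3 : (n : ℕ) (F : CNF n) (ε δ : ℚ) (ε>0 : 0ℚ < ε) → ε ≤ 1ℚ → (δ>0 : 0ℚ < δ) → δ ≤ 1ℚ →
    (pivot t : ℕ) → IsPivot ε ε>0 pivot → IsT δ δ>0 t →
    PrAtLeast (allApproxMCTapes n pivot t)
    (λ ω → inRange ε ε>0 (∣R F ∣) (ApproxMCRun F pivot t ω))
    (1ℚ - δ)
theorem3 n F ε δ ε>0 ε≤1 δ>0 δ≤1 pivot t isPivot isT =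
  failure-bound⇒PrAtLeast Ω success δ
    (ratio-bound (∑ Ω (𝟙 ∘ not ∘ success)) (length Ω) (49 ℕ.^ t) (50 ℕ.^ t) δ (ℕ.m^n>0 50 t) amplified
      (iterations-suffice δ δ>0 t isT))
  where
  R : ℕ
  R = ∣R F ∣
  lo hi : ℚ
  lo = lower ε ε>0 R
  hi = upper ε ε>0 R
  Ω = allApproxMCTapes n pivot t
  success : ApproxMCTape n pivot t → Bool
  success ω = inRange ε ε>0 R (ApproxMCRun F pivot t ω)
  inRange≡ : ∀ m → withinMaybe lo hi m ≡ inRange ε ε>0 R m
  inRange≡ nothing  = refl
  inRange≡ (just _) = refl
  amplified : ∑ Ω (𝟙 ∘ not ∘ success) ℕ.* 50 ℕ.^ t ℕ.≤ 49 ℕ.^ t ℕ.* length Ω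
  amplified = subst (λ B → B ℕ.* 50 ℕ.^ t ℕ.≤ 49 ℕ.^ t ℕ.* length Ω)
    (∑-cong Ω (λ ω → cong (𝟙 ∘ not) (inRange≡ (ApproxMCRun F pivot t ω))))
    (median-amplification (allCoreTapesFor n pivot) (ApproxMCCore F pivot) lo hi t
      (core-success F pivot (within lo hi ∘ ℕ→ℚ) (pivot≥40 ε ε>0 ε≤1 pivot isPivot)
        (exact-within ε ε>0 R) (outside⇒far ε ε>0 pivot isPivot R)))
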